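{- (i) Let $S\equiv\pm\{1, 4, 7, 9, 10, 11, 12, 13, 14, 15, 17, 23\}\pmod{48}$ and $T\equiv\pm\{1, 3, 7, 8, 10, 11, 12, 13, 17, 21, 22, 23\}\pmod{48}$. Then $p(S,n)=p(T,n-1)$ for all $n\geq 1$. (ii) Let $S\equiv\pm\{2, 5, 7, 8, 9, 11, 12, 13, 14, 15, 17, 19\}\pmod{48}$ and $T\equiv\pm\{2, 3, 5, 7, 11, 12, 13, 17, 19, 20, 21, 22\}\pmod{48}$. Then $p(S,n)=p(T,n-2)$ for all $n\geq 2$. (iii) Let $S\equiv\pm\{1, 3, 5, 7, 8, 10, 12, 17, 19, 21, 22, 23\}\pmod{48}$ and $T\equiv\pm\{1, 2, 5, 7, 9, 12, 15, 17, 19, 20, 22, 23\}\pmod{48}$. Then $p(S,n)=p(T,n-1)$ for all $n\geq 1$. (iv) Let $S\equiv\pm\{1, 2, 5, 8, 9, 11, 12, 13, 14, 15, 19, 23\}\pmod{48}$ and $T\equiv\pm\{1, 3, 4, 5, 10, 11, 12, 13, 14, 19, 21, 23\}\pmod{48}$. Then $p(S,n)=p(T,n)$ for all integers $n\ge0$ with $n\neq 2$.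
   Context: For a set $S$ of positive integers and an integer $n\ge 0$, $p(S,n)$ denotes the number of partitions of $n$ into parts belonging to $S$ (so $p(S,0)=1$). The notation $S\equiv\pm\{r_1,\dots,r_k\}\pmod M$ means that $S$ is the set of all positive integers $n$ such that $n\equiv r_i$ or $n\equiv -r_i\pmod M$ for some $i$. -}

module Defs where

open import Data.Nat using (ℕ; zero; suc; _+_; _*_; _∸_; _%_; _≡ᵇ_)
open import Data.Bool using (Bool; true; false; if_then_else_; _∨_)
open import Data.List using (List; []; _∷_)
open import Data.Bool.ListAction using (any)

-- A set of positive integers is represented by its (decidable) characteristic
-- function ℕ → Bool; only its values on positive integers matter below.

-- The set S ≡ ± {r₁,…,r_k} (mod M): all positive n with n ≡ rᵢ or n ≡ -rᵢ (mod M).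
-- n ≡ r (mod M)  ⇔  n % M ≡ r % M ;  n ≡ -r (mod M) ⇔ (n + r) % M ≡ 0.
pmSet : (M : ℕ) → List ℕ → ℕ → Bool
pmSet zero    rs n = false
pmSet (suc m) rs zero = false
pmSet (suc m) rs (suc n) =
  any (λ r → ((suc n % suc m) ≡ᵇ (r % suc m)) ∨ (((suc n + r) % suc m) ≡ᵇ 0)) rs

-- sum of f m over multiplicities m with m * k ≤ n, i.e. m = 0 … ⌊n/k⌋, for k ≥ 1:
-- sumMult f k n fuel enumerates m = 0,1,… while m*k ≤ n.
-- count S k n : number of partitions of n into parts belonging to S that are all ≤ k.
-- Parts of size j (1 ≤ j ≤ k) are chosen with multiplicity m_j ≥ 0.
multSum : (ℕ → ℕ) → (k n : ℕ) → ℕ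
multSum f k n = go n n
  where
  -- go fuel r : Σ over m ≥ 0 with m*k ≤ r of f (r ∸ m*k); fuel bounds the
  -- number of steps (fuel = n suffices since k ≥ 1)
  go : ℕ → ℕ → ℕ
  go zero    r = f r
  go (suc t) r with k Data.Nat.≤ᵇ r
  ... | true  = f r + go t (r ∸ k)
  ... | false = f r

count : (ℕ → Bool) → ℕ → ℕ → ℕ
count S zero    n = if n ≡ᵇ 0 then 1 else 0
count S (suc k) n =
  if S (suc k) then multSum (count S k) (suc k) n else count S k n

-- p(S,n): the number of partitions of n into parts belonging to S (p(S,0) = 1).
-- Every part of a partition of n is at most n.
p : (ℕ → Bool) → ℕ → ℕ
p S n = count S n n

{-# OPTIONS --safe #-}

-- Write [S] for the product of the 1 − qⁿ over n in S. The claims amount to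
-- [T] = q^s [S] + [S] [T] in (i)–(iii) and to [T] = [S] + q² [S] [T] in (iv). Each of them is a
-- combination of three instances of Weierstrass's three-term relation for the theta function
-- θ(x) = (x; p)_∞ (p/x; p)_∞ with p = q²⁴ at points ±q^α, every θ(±q^a) being a quotient of products
-- of the (q^r; q⁴⁸)_∞. The three-term relation itself is a Plücker relation: by Jacobi's triple
-- product, θ(xy) θ(x/y) is, up to a factor depending on p only, a 2 × 2 determinant in bilateral
-- series e and o of x² and y². All of this takes place in ℤ[[q]]/(q^m), where p is nilpotent and
-- every product and bilateral sum is finite.

module Submission where

open import Defs
open import Algebra using (CommutativeMonoid; CommutativeRing; RawRing)
open import Data.Bool using (Bool; true; false; if_then_else_; _∨_; _xor_)
open import Data.Bool.ListAction using (all; any)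
open import Data.Integer as ℤ using (ℤ; +_; -[1+_]; _⊖_; ∣_∣)
import Data.Integer.Properties as ℤₚ
open import Data.Integer.Tactic.RingSolver using (solve-∀)
open import Data.List using (List; []; _∷_; _++_; map)
open import Data.Maybe using (Maybe; just; nothing)
open import Data.Nat as ℕ using (ℕ; zero; suc; z≤n; s≤s; _≥_; _∸_)
open import Data.Nat.DivMod using ([m+kn]%n≡m%n)
import Data.Nat.Properties as ℕₚ
import Data.Nat.Tactic.RingSolver as ℕ-Solver
open import Data.Product using (_×_; _,_; ∃)
open import Data.Sum using (inj₁; inj₂)
open import Function using (_∘_)
open import Level using (0ℓ)
open import Relation.Binary.PropositionalEquality as ≡ using (_≡_; _≢_)
open import Relation.Nullary using (yes; no; contradiction)

-- The truncated ring has no negative powers of q, and this shapes every statement about theta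
-- functions. Theta takes two arguments `x` and `y` with `x * y ≈ p` instead of x and p/x; the term
-- x^k p^(k(k-1)/2) becomes the monomial `x ^ T k * y ^ T′ k`; and the four points of Weierstrass's
-- relation enter only through the ratios `b₁`, `b₂`, `b₃` of neighbours and through `V` = v² and
-- `W` = p/x². Both exponents of such a monomial are large when |k| is large, so it contains a high
-- power of `p` and vanishes: every identity is an exact identity between finite sums, and no limit
-- is taken. Products over positive residues are units. Dividing by [S] [T] gives 1/[S] = q^s/[T] +
-- 1 in (i)-(iii) and 1/[S] = 1/[T] + q² in (iv). The summand 1 affects the coefficient of q⁰ only,
-- and the summand q² is the exception n = 2. The coefficient of q^n is read off in a truncation of
-- order greater than n.

-- Finite sums and products over initial segments of ℕ

module Folds {c ℓ} (M : CommutativeMonoid c ℓ) where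
  open CommutativeMonoid M
  open import Algebra.Properties.CommutativeSemigroup commutativeSemigroup using (interchange)
  open import Relation.Binary.Reasoning.Setoid setoid

  fold : ℕ → (ℕ → Carrier) → Carrier
  fold zero    f = ε
  fold (suc n) f = f 0 ∙ fold n (f ∘ suc)

  fold-cong< : ∀ n {f g : ℕ → Carrier} → (∀ i → i ℕ.< n → f i ≈ g i) → fold n f ≈ fold n g
  fold-cong< zero    h = refl
  fold-cong< (suc n) h = ∙-cong (h 0 (s≤s z≤n)) (fold-cong< n λ i i<n → h (suc i) (s≤s i<n))

  fold-cong : ∀ n {f g : ℕ → Carrier} → (∀ i → f i ≈ g i) → fold n f ≈ fold n g
  fold-cong n h = fold-cong< n λ i _ → h i

  fold-ε : ∀ n {f : ℕ → Carrier} → (∀ i → i ℕ.< n → f i ≈ ε) → fold n f ≈ ε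
  fold-ε zero    h = refl
  fold-ε (suc n) h = trans (∙-cong (h 0 (s≤s z≤n)) (fold-ε n λ i i<n → h (suc i) (s≤s i<n))) (identityˡ ε)

  fold-∙ : ∀ n (f g : ℕ → Carrier) → fold n (λ i → f i ∙ g i) ≈ fold n f ∙ fold n g
  fold-∙ zero    f g = sym (identityˡ ε)
  fold-∙ (suc n) f g = trans (∙-congˡ (fold-∙ n (f ∘ suc) (g ∘ suc))) (interchange _ _ _ _)

  fold-split : ∀ m n (f : ℕ → Carrier) → fold (m ℕ.+ n) f ≈ fold m f ∙ fold n (λ i → f (m ℕ.+ i))
  fold-split zero    n f = sym (identityˡ _)
  fold-split (suc m) n f = trans (∙-congˡ (fold-split m n (f ∘ suc))) (sym (assoc _ _ _))

  fold-snoc : ∀ n (f : ℕ → Carrier) → fold (suc n) f ≈ fold n f ∙ f n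
  fold-snoc zero    f = trans (identityʳ _) (sym (identityˡ _))
  fold-snoc (suc n) f = trans (∙-congˡ (fold-snoc n (f ∘ suc))) (sym (assoc _ _ _))

  fold-swap : ∀ m n (f : ℕ → ℕ → Carrier) →
    fold m (λ i → fold n (f i)) ≈ fold n (λ j → fold m (λ i → f i j))
  fold-swap zero    n f = sym (fold-ε n λ _ _ → refl)
  fold-swap (suc m) n f = trans (∙-congˡ (fold-swap m n (f ∘ suc))) (sym (fold-∙ n _ _))

  fold-double : ∀ n (f : ℕ → Carrier) →
    fold (n ℕ.+ n) f ≈ fold n (λ i → f (i ℕ.+ i) ∙ f (suc (i ℕ.+ i)))
  fold-double zero    f = refl
  fold-double (suc n) f rewrite ℕₚ.+-suc n n = trans (sym (assoc _ _ _))
    (∙-congˡ (trans (fold-double n (λ i → f (suc (suc i))))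
      (fold-cong n λ i → reflexive (≡.cong (λ j → f (suc j) ∙ f (suc (suc j))) (≡.sym (ℕₚ.+-suc i i))))))

-- Calculation in an arbitrary commutative ring

module RingTheory {c ℓ} (R : CommutativeRing c ℓ) where
  open CommutativeRing R public
  open import Algebra.Properties.Ring ring public
    using (-‿distribˡ-*; -‿distribʳ-*; -‿involutive; -0#≈0#)
  open import Algebra.Properties.AbelianGroup +-abelianGroup using (⁻¹-∙-comm)
  open import Algebra.Properties.CommutativeSemiring.Exp commutativeSemiring public
    using (_^_; ^-congˡ; ^-congʳ; ^-homo-*; ^-assocʳ; ^-distrib-*)
  open import Algebra.Properties.Semiring.Mult semiring using (×-homo-+; ×1-homo-*) renaming (_×_ to _×ᴿ_)
  open import Algebra.Properties.CommutativeSemigroup +-commutativeSemigroup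
    using () renaming (interchange to +-interchange)
  open import Relation.Binary.Reasoning.Setoid setoid public
  open import Algebra.Solver.Ring.AlmostCommutativeRing

  open Folds +-commutativeMonoid public renaming
    ( fold to ∑; fold-cong< to ∑-cong<; fold-cong to ∑-cong; fold-ε to ∑-0; fold-∙ to ∑-+
    ; fold-split to ∑-split; fold-snoc to ∑-snoc; fold-swap to ∑-swap; fold-double to ∑-double)
  open Folds *-commutativeMonoid public renaming
    ( fold to ∏; fold-cong< to ∏-cong<; fold-cong to ∏-cong; fold-ε to ∏-1; fold-∙ to ∏-*
    ; fold-split to ∏-split; fold-snoc to ∏-snoc; fold-swap to ∏-swap; fold-double to ∏-double)

  ∑-*ˡ : ∀ n a (f : ℕ → Carrier) → a * ∑ n f ≈ ∑ n (λ i → a * f i)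
  ∑-*ˡ zero    a f = zeroʳ a
  ∑-*ˡ (suc n) a f = trans (distribˡ a _ _) (+-congˡ (∑-*ˡ n a (f ∘ suc)))

  ∑-*ʳ : ∀ n a (f : ℕ → Carrier) → ∑ n f * a ≈ ∑ n (λ i → f i * a)
  ∑-*ʳ n a f = trans (*-comm _ a) (trans (∑-*ˡ n a f) (∑-cong n λ i → *-comm a _))

  -- The solver needs coefficients with decidable equality: a pair (a , b) stands for a − b.
  private
    ⟦_⟧ᶜ : ℕ × ℕ → Carrier
    ⟦ a , b ⟧ᶜ = (a ×ᴿ 1#) - (b ×ᴿ 1#)

    normalise : ℕ → ℕ → ℕ × ℕ
    normalise (suc a) (suc b) = normalise a b
    normalise a       b       = a , b

    normalise-≡ : ∀ a b → let (c , d) = normalise a b in a ℕ.+ d ≡ c ℕ.+ b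
    normalise-≡ zero    b       = ≡.refl
    normalise-≡ (suc a) zero    = ≡.refl
    normalise-≡ (suc a) (suc b) = ≡.trans (≡.cong suc (normalise-≡ a b)) (≡.sym (ℕₚ.+-suc _ b))

    coefficients : RawRing _ _
    coefficients = record
      { Carrier = ℕ × ℕ
      ; _≈_ = _≡_
      ; _+_ = λ (a , b) (c , d) → normalise (a ℕ.+ c) (b ℕ.+ d)
      ; _*_ = λ (a , b) (c , d) → normalise (a ℕ.* c ℕ.+ b ℕ.* d) (a ℕ.* d ℕ.+ b ℕ.* c)
      ; -_ = λ (a , b) → b , a
      ; 0# = 0 , 0
      ; 1# = 1 , 0
      }

    -[]-distrib : ∀ x y → - (x + y) ≈ - x + - y
    -[]-distrib x y = sym (⁻¹-∙-comm x y)

    ⟦⟧ᶜ-* : ∀ a b c d →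
      ((a ℕ.* c ℕ.+ b ℕ.* d) ×ᴿ 1#) - ((a ℕ.* d ℕ.+ b ℕ.* c) ×ᴿ 1#)
        ≈ ((a ×ᴿ 1#) - (b ×ᴿ 1#)) * ((c ×ᴿ 1#) - (d ×ᴿ 1#))
    ⟦⟧ᶜ-* a b c d = begin
      ((a ℕ.* c ℕ.+ b ℕ.* d) ×ᴿ 1#) - ((a ℕ.* d ℕ.+ b ℕ.* c) ×ᴿ 1#)
        ≈⟨ +-cong (homo a c b d) (trans (-‿cong (homo a d b c)) (-[]-distrib _ _)) ⟩
      (A * C + B * D) + (- (A * D) + - (B * C))
        ≈⟨ +-interchange _ _ _ _ ⟩
      (A * C + - (A * D)) + (B * D + - (B * C))
        ≈⟨ +-cong (trans (+-congˡ (-‿distribʳ-* A D)) (sym (distribˡ A C (- D))))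
                  (trans (+-comm _ _) (trans (+-cong (-‿distribˡ-* B C) BD) (sym (distribˡ (- B) C (- D))))) ⟩
      A * (C - D) + (- B) * (C - D)
        ≈⟨ distribʳ _ _ _ ⟨
      (A - B) * (C - D) ∎
      where
      A = a ×ᴿ 1#
      B = b ×ᴿ 1#
      C = c ×ᴿ 1#
      D = d ×ᴿ 1#
      homo : ∀ a b c d → (a ℕ.* b ℕ.+ c ℕ.* d) ×ᴿ 1# ≈ (a ×ᴿ 1#) * (b ×ᴿ 1#) + (c ×ᴿ 1#) * (d ×ᴿ 1#)
      homo a b c d = trans (×-homo-+ 1# (a ℕ.* b) (c ℕ.* d)) (+-cong (×1-homo-* a b) (×1-homo-* c d))
      BD : B * D ≈ - B * - D
      BD = trans (sym (-‿involutive _)) (trans (-‿cong (-‿distribˡ-* B D)) (-‿distribʳ-* (- B) D))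

    ⟦⟧ᶜ-≈ : ∀ a b c d → a ℕ.+ d ≡ c ℕ.+ b → ⟦ a , b ⟧ᶜ ≈ ⟦ c , d ⟧ᶜ
    ⟦⟧ᶜ-≈ a b c d e = begin
      A - B                     ≈⟨ +-identityʳ _ ⟨
      (A - B) + 0#              ≈⟨ +-congˡ (-‿inverseʳ D) ⟨
      (A - B) + (D - D)         ≈⟨ +-interchange _ _ _ _ ⟩
      (A + D) + (- B + - D)     ≈⟨ +-congʳ (×-homo-+ 1# a d) ⟨
      ((a ℕ.+ d) ×ᴿ 1#) + (- B + - D) ≈⟨ +-cong (reflexive (≡.cong (_×ᴿ 1#) e)) (+-comm _ _) ⟩
      ((c ℕ.+ b) ×ᴿ 1#) + (- D + - B) ≈⟨ +-congʳ (×-homo-+ 1# c b) ⟩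
      (C + B) + (- D + - B)     ≈⟨ +-interchange _ _ _ _ ⟩
      (C - D) + (B - B)         ≈⟨ +-congˡ (-‿inverseʳ B) ⟩
      (C - D) + 0#              ≈⟨ +-identityʳ _ ⟩
      C - D                     ∎
      where
      A = a ×ᴿ 1#
      B = b ×ᴿ 1#
      C = c ×ᴿ 1#
      D = d ×ᴿ 1#

    ⟦normalise⟧ᶜ : ∀ a b → ⟦ normalise a b ⟧ᶜ ≈ ⟦ a , b ⟧ᶜ
    ⟦normalise⟧ᶜ a b = sym (⟦⟧ᶜ-≈ a b _ _ (normalise-≡ a b))

    -- The coefficients 0 and 1 are interpreted as `0#` and `1#` themselves, not as differences of
    -- multiples of `1#`, so that polynomials containing `:1` evaluate to the terms that occur in
    -- the goals.
    ⟦_⟧ˢ : ℕ × ℕ → Carrier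
    ⟦ 0 , 0 ⟧ˢ = 0#
    ⟦ 1 , 0 ⟧ˢ = 1#
    ⟦ a , b ⟧ˢ = ⟦ a , b ⟧ᶜ

    ⟦⟧ˢ≈⟦⟧ᶜ : ∀ x → ⟦ x ⟧ˢ ≈ ⟦ x ⟧ᶜ
    ⟦⟧ˢ≈⟦⟧ᶜ (0 , 0)           = sym (-‿inverseʳ 0#)
    ⟦⟧ˢ≈⟦⟧ᶜ (1 , 0)           = sym (trans (+-cong (+-identityʳ 1#) -0#≈0#) (+-identityʳ 1#))
    ⟦⟧ˢ≈⟦⟧ᶜ (0 , suc b)       = refl
    ⟦⟧ˢ≈⟦⟧ᶜ (1 , suc b)       = refl
    ⟦⟧ˢ≈⟦⟧ᶜ (suc (suc a) , b) = refl

    morphism : coefficients -Raw-AlmostCommutative⟶ fromCommutativeRing R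
    morphism = record
      { ⟦_⟧ = ⟦_⟧ˢ
      ; +-homo = λ x@(a , b) y@(c , d) → begin
          ⟦ normalise (a ℕ.+ c) (b ℕ.+ d) ⟧ˢ  ≈⟨ ⟦⟧ˢ≈⟦⟧ᶜ (normalise (a ℕ.+ c) (b ℕ.+ d)) ⟩
          ⟦ normalise (a ℕ.+ c) (b ℕ.+ d) ⟧ᶜ  ≈⟨ ⟦normalise⟧ᶜ (a ℕ.+ c) (b ℕ.+ d) ⟩
          ((a ℕ.+ c) ×ᴿ 1#) - ((b ℕ.+ d) ×ᴿ 1#)
            ≈⟨ +-cong (×-homo-+ 1# a c) (trans (-‿cong (×-homo-+ 1# b d)) (-[]-distrib _ _)) ⟩
          ((a ×ᴿ 1#) + (c ×ᴿ 1#)) + (- (b ×ᴿ 1#) - (d ×ᴿ 1#))  ≈⟨ +-interchange _ _ _ _ ⟩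
          ⟦ x ⟧ᶜ + ⟦ y ⟧ᶜ         ≈⟨ +-cong (⟦⟧ˢ≈⟦⟧ᶜ x) (⟦⟧ˢ≈⟦⟧ᶜ y) ⟨
          ⟦ x ⟧ˢ + ⟦ y ⟧ˢ         ∎
      ; *-homo = λ x@(a , b) y@(c , d) → begin
          ⟦ normalise (a ℕ.* c ℕ.+ b ℕ.* d) (a ℕ.* d ℕ.+ b ℕ.* c) ⟧ˢ
            ≈⟨ ⟦⟧ˢ≈⟦⟧ᶜ (normalise (a ℕ.* c ℕ.+ b ℕ.* d) (a ℕ.* d ℕ.+ b ℕ.* c)) ⟩
          ⟦ normalise (a ℕ.* c ℕ.+ b ℕ.* d) (a ℕ.* d ℕ.+ b ℕ.* c) ⟧ᶜ
            ≈⟨ ⟦normalise⟧ᶜ (a ℕ.* c ℕ.+ b ℕ.* d) (a ℕ.* d ℕ.+ b ℕ.* c) ⟩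
          ⟦ a ℕ.* c ℕ.+ b ℕ.* d , a ℕ.* d ℕ.+ b ℕ.* c ⟧ᶜ  ≈⟨ ⟦⟧ᶜ-* a b c d ⟩
          ⟦ x ⟧ᶜ * ⟦ y ⟧ᶜ         ≈⟨ *-cong (⟦⟧ˢ≈⟦⟧ᶜ x) (⟦⟧ˢ≈⟦⟧ᶜ y) ⟨
          ⟦ x ⟧ˢ * ⟦ y ⟧ˢ         ∎
      ; -‿homo = λ x@(a , b) → begin
          ⟦ b , a ⟧ˢ                 ≈⟨ ⟦⟧ˢ≈⟦⟧ᶜ (b , a) ⟩
          (b ×ᴿ 1#) - (a ×ᴿ 1#)      ≈⟨ +-comm _ _ ⟩
          - (a ×ᴿ 1#) + (b ×ᴿ 1#)    ≈⟨ +-congˡ (-‿involutive _) ⟨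
          - (a ×ᴿ 1#) - - (b ×ᴿ 1#)  ≈⟨ -[]-distrib _ _ ⟨
          - ⟦ x ⟧ᶜ                   ≈⟨ -‿cong (⟦⟧ˢ≈⟦⟧ᶜ x) ⟨
          - ⟦ x ⟧ˢ                   ∎
      ; 0-homo = refl
      ; 1-homo = refl
      }

    coeff≟ : ∀ x y → Maybe (⟦ x ⟧ˢ ≈ ⟦ y ⟧ˢ)
    coeff≟ x@(a , b) y@(c , d) with a ℕ.+ d ℕ.≟ c ℕ.+ b
    ... | no _  = nothing
    ... | yes e = just (trans (⟦⟧ˢ≈⟦⟧ᶜ x) (trans (⟦⟧ᶜ-≈ a b c d e) (sym (⟦⟧ˢ≈⟦⟧ᶜ y))))

  open import Algebra.Solver.Ring coefficients (fromCommutativeRing R) morphism coeff≟ public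
    using (solve; _:=_; _:+_; _:*_; :-_; _:-_; con; Polynomial)

  :1 : ∀ {n} → Polynomial n
  :1 = con (1 , 0)

-- Jacobi's triple product

triangle : ℕ → ℕ
triangle zero    = 0
triangle (suc n) = suc n ℕ.+ triangle n

-- T k = k(k+1)/2 and T′ k = k(k−1)/2.
T T′ : ℤ → ℕ
T (+ n)    = triangle n
T -[1+ n ] = triangle n

T′ (+ zero)  = 0
T′ (+ suc n) = triangle n
T′ -[1+ n ]  = triangle (suc n)

triangle≡n+T′ : ∀ n → triangle n ≡ n ℕ.+ T′ (+ n)
triangle≡n+T′ zero    = ≡.refl
triangle≡n+T′ (suc n) = ≡.refl

-- For k = i - b this is T k - T (k-1) = k, and `T′-step` is T′ k - T′ (k-1) = k - 1, with i and b
-- distributed over the two sides so that only natural numbers occur as exponents.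
T-step : ∀ i b → i ℕ.+ T (i ⊖ suc b) ≡ b ℕ.+ T (i ⊖ b)
T-step zero    zero    = ≡.refl
T-step zero    (suc b) = ≡.refl
T-step (suc i) zero    = ≡.refl
T-step (suc i) (suc b) rewrite ℤₚ.[1+m]⊖[1+n]≡m⊖n i (suc b) | ℤₚ.[1+m]⊖[1+n]≡m⊖n i b = ≡.cong suc (T-step i b)

T′-step : ∀ i b → i ℕ.+ T′ (i ⊖ suc b) ≡ suc b ℕ.+ T′ (i ⊖ b)
T′-step zero          zero    = ≡.refl
T′-step zero          (suc b) = ≡.refl
T′-step (suc zero)    zero    = ≡.refl
T′-step (suc (suc i)) zero    = ≡.refl
T′-step (suc i)       (suc b) rewrite ℤₚ.[1+m]⊖[1+n]≡m⊖n i (suc b) | ℤₚ.[1+m]⊖[1+n]≡m⊖n i b = ≡.cong suc (T′-step i b)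

module TripleProduct {c ℓ} (R : CommutativeRing c ℓ) where
  open RingTheory R public

  ^-≤-0 : ∀ {p m n} → p ^ m ≈ 0# → m ℕ.≤ n → p ^ n ≈ 0#
  ^-≤-0 {p} {m} {n} pᵐ≈0 m≤n = begin
    p ^ n                  ≈⟨ ^-congʳ p (≡.sym (ℕₚ.m+[n∸m]≡n m≤n)) ⟩
    p ^ (m ℕ.+ (n ℕ.∸ m))  ≈⟨ ^-homo-* p m _ ⟩
    p ^ m * p ^ (n ℕ.∸ m)  ≈⟨ *-congʳ pᵐ≈0 ⟩
    0# * p ^ (n ℕ.∸ m)     ≈⟨ zeroˡ _ ⟩
    0# ∎

  module _ (p : Carrier) where

    gaussian : ℕ → ℕ → Carrier
    gaussian zero    zero    = 1#
    gaussian zero    (suc i) = 0#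
    gaussian (suc N) zero    = 1#
    gaussian (suc N) (suc i) = gaussian N i + p ^ suc i * gaussian N (suc i)

    gaussian-0 : ∀ N → gaussian N 0 ≈ 1#
    gaussian-0 zero    = refl
    gaussian-0 (suc N) = refl

    gaussian-> : ∀ {N i} → N ℕ.< i → gaussian N i ≈ 0#
    gaussian-> {zero}  {suc i} _         = refl
    gaussian-> {suc N} {suc i} (s≤s N<i) = trans
      (+-cong (gaussian-> N<i) (trans (*-congˡ (gaussian-> (ℕₚ.m<n⇒m<1+n N<i))) (zeroʳ _))) (+-identityˡ 0#)

    gaussian-ratio : ∀ i j → (1# - p ^ suc i) * gaussian (i ℕ.+ j) (suc i) ≈ (1# - p ^ j) * gaussian (i ℕ.+ j) i
    gaussian-ratio i zero = begin
      (1# - p ^ suc i) * gaussian (i ℕ.+ 0) (suc i)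
        ≈⟨ *-congˡ (gaussian-> (ℕₚ.≤-reflexive (≡.cong suc (ℕₚ.+-identityʳ i)))) ⟩
      (1# - p ^ suc i) * 0#  ≈⟨ zeroʳ _ ⟩
      0#                     ≈⟨ zeroˡ _ ⟨
      0# * gaussian (i ℕ.+ 0) i   ≈⟨ *-congʳ (-‿inverseʳ 1#) ⟨
      (1# - 1#) * gaussian (i ℕ.+ 0) i  ∎
    gaussian-ratio i (suc j) rewrite ℕₚ.+-suc i j = begin
      (1# - P) * (g₀ + P * g₁)
        ≈⟨ solve 3 (λ P g₀ g₁ → (:1 :- P) :* (g₀ :+ P :* g₁) := (:1 :- P) :* g₀ :+ P :* ((:1 :- P) :* g₁)) refl P g₀ g₁ ⟩
      (1# - P) * g₀ + P * ((1# - P) * g₁)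
        ≈⟨ +-congˡ (*-congˡ (gaussian-ratio i j)) ⟩
      (1# - P) * g₀ + P * ((1# - p ^ j) * g₀)
        ≈⟨ solve 3 (λ P Q g₀ → (:1 :- P) :* g₀ :+ P :* ((:1 :- Q) :* g₀) := (:1 :- P :* Q) :* g₀) refl P (p ^ j) g₀ ⟩
      (1# - P * p ^ j) * g₀
        ≈⟨ *-congʳ (+-congˡ (-‿cong (sym (^-homo-* p (suc i) j)))) ⟩
      (1# - p ^ (suc i ℕ.+ j)) * g₀
        ≈⟨ second i ⟩
      (1# - p ^ suc j) * gaussian (suc (i ℕ.+ j)) i ∎
      where
      P = p ^ suc i
      g₀ = gaussian (i ℕ.+ j) i
      g₁ = gaussian (i ℕ.+ j) (suc i)
      second : ∀ i → (1# - p ^ (suc i ℕ.+ j)) * gaussian (i ℕ.+ j) i ≈ (1# - p ^ suc j) * gaussian (suc (i ℕ.+ j)) i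
      second zero    = *-congˡ (gaussian-0 j)
      second (suc i) = begin
        (1# - p ^ (suc (suc i) ℕ.+ j)) * b
          ≈⟨ *-congʳ (+-congˡ (-‿cong (trans (^-congʳ p (≡.cong suc (≡.sym (ℕₚ.+-suc i j)))) (^-homo-* p (suc i) (suc j))))) ⟩
        (1# - S * Q) * b
          ≈⟨ solve 3 (λ S Q b → (:1 :- S :* Q) :* b := (:1 :- S) :* b :+ S :* ((:1 :- Q) :* b)) refl S Q b ⟩
        (1# - S) * b + S * ((1# - Q) * b)
          ≈⟨ +-congʳ ratio ⟩
        (1# - Q) * a + S * ((1# - Q) * b)
          ≈⟨ solve 4 (λ S Q a b → (:1 :- Q) :* a :+ S :* ((:1 :- Q) :* b) := (:1 :- Q) :* (a :+ S :* b)) refl S Q a b ⟩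
        (1# - Q) * (a + S * b) ∎
        where
        S = p ^ suc i
        Q = p ^ suc j
        a = gaussian (suc i ℕ.+ j) i
        b = gaussian (suc i ℕ.+ j) (suc i)
        ratio : (1# - S) * b ≈ (1# - Q) * a
        ratio = ≡.subst (λ N → (1# - S) * gaussian N (suc i) ≈ (1# - Q) * gaussian N i) (ℕₚ.+-suc i j) (gaussian-ratio i (suc j))

    -- Pascal's rule in summed form. Multiplying a product by one more linear factor has the effect
    -- on `h` seen on the right, so this is the induction step of both `q-binomial` and
    -- `finite-triple-product`.
    ∑-gaussian : ∀ N (h : ℕ → Carrier) →
      ∑ (suc (suc N)) (λ i → gaussian (suc N) i * h i)
        ≈ ∑ (suc N) (λ i → gaussian N i * (h (suc i) + p ^ i * h i))
    ∑-gaussian N h = begin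
      1# * h 0 + ∑ (suc N) (λ i → (gaussian N i + p ^ suc i * gaussian N (suc i)) * h (suc i))
        ≈⟨ +-cong (*-congʳ (sym (gaussian-0 N))) (∑-cong (suc N) λ i →
             solve 4 (λ g g′ q h → (g :+ q :* g′) :* h := g :* h :+ g′ :* (q :* h)) refl (gaussian N i) (gaussian N (suc i)) (p ^ suc i) (h (suc i))) ⟩
      gaussian N 0 * h 0 + ∑ (suc N) (λ i → gaussian N i * h (suc i) + gaussian N (suc i) * (p ^ suc i * h (suc i)))
        ≈⟨ +-cong (*-congˡ (sym (*-identityˡ _))) (∑-+ (suc N) g (k ∘ suc)) ⟩
      k 0 + (∑ (suc N) (λ i → gaussian N i * h (suc i)) + ∑ (suc N) (k ∘ suc))
        ≈⟨ solve 3 (λ a b c → a :+ (b :+ c) := b :+ (a :+ c)) refl _ _ _ ⟩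
      ∑ (suc N) (λ i → gaussian N i * h (suc i)) + ∑ (suc (suc N)) k
        ≈⟨ +-congˡ (∑-snoc (suc N) k) ⟩
      ∑ (suc N) (λ i → gaussian N i * h (suc i)) + (∑ (suc N) k + k (suc N))
        ≈⟨ +-congˡ (trans (+-congˡ (trans (*-congʳ (gaussian-> (ℕₚ.n<1+n N))) (zeroˡ _))) (+-identityʳ _)) ⟩
      ∑ (suc N) (λ i → gaussian N i * h (suc i)) + ∑ (suc N) k
        ≈⟨ ∑-+ (suc N) g k ⟨
      ∑ (suc N) (λ i → gaussian N i * h (suc i) + k i)
        ≈⟨ ∑-cong (suc N) (λ i → distribˡ (gaussian N i) (h (suc i)) (p ^ i * h i)) ⟨
      ∑ (suc N) (λ i → gaussian N i * (h (suc i) + p ^ i * h i)) ∎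
      where
      g k : ℕ → Carrier
      g i = gaussian N i * h (suc i)
      k i = gaussian N i * (p ^ i * h i)

    q-binomial : ∀ a x → ∏ a (λ i → 1# + x * p ^ i) ≈ ∑ (suc a) (λ i → gaussian a i * (x ^ i * p ^ T′ (+ i)))
    q-binomial zero    x = sym (trans (+-identityʳ _) (trans (*-identityˡ _) (*-identityˡ _)))
    q-binomial (suc a) x = begin
      (1# + x * 1#) * ∏ a (λ i → 1# + x * (p * p ^ i))
        ≈⟨ *-cong (+-congˡ (*-identityʳ x)) (∏-cong a λ i → +-congˡ (sym (*-assoc x p _))) ⟩
      (1# + x) * ∏ a (λ i → 1# + (x * p) * p ^ i)
        ≈⟨ *-congˡ (q-binomial a (x * p)) ⟩
      (1# + x) * ∑ (suc a) (λ i → gaussian a i * ((x * p) ^ i * p ^ T′ (+ i)))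
        ≈⟨ ∑-*ˡ (suc a) (1# + x) (λ i → gaussian a i * ((x * p) ^ i * p ^ T′ (+ i))) ⟩
      ∑ (suc a) (λ i → (1# + x) * (gaussian a i * ((x * p) ^ i * p ^ T′ (+ i))))
        ≈⟨ ∑-cong (suc a) (λ i → begin
             (1# + x) * (gaussian a i * ((x * p) ^ i * p ^ T′ (+ i)))
               ≈⟨ *-congˡ (*-congˡ (*-congʳ (^-distrib-* x p i))) ⟩
             (1# + x) * (gaussian a i * ((x ^ i * p ^ i) * p ^ T′ (+ i)))
               ≈⟨ solve 5 (λ x g X P Q → (:1 :+ x) :* (g :* ((X :* P) :* Q)) := g :* (x :* X :* (P :* Q) :+ P :* (X :* Q)))
                    refl x (gaussian a i) (x ^ i) (p ^ i) (p ^ T′ (+ i)) ⟩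
             gaussian a i * (x ^ suc i * (p ^ i * p ^ T′ (+ i)) + p ^ i * (x ^ i * p ^ T′ (+ i)))
               ≈⟨ *-congˡ (+-congʳ (*-congˡ (trans (sym (^-homo-* p i _)) (^-congʳ p (≡.sym (triangle≡n+T′ i)))))) ⟩
             gaussian a i * (x ^ suc i * p ^ T′ (+ suc i) + p ^ i * (x ^ i * p ^ T′ (+ i))) ∎) ⟩
      ∑ (suc a) (λ i → gaussian a i * (x ^ suc i * p ^ T′ (+ suc i) + p ^ i * (x ^ i * p ^ T′ (+ i))))
        ≈⟨ ∑-gaussian a (λ i → x ^ i * p ^ T′ (+ i)) ⟨
      ∑ (suc (suc a)) (λ i → gaussian (suc a) i * (x ^ i * p ^ T′ (+ i))) ∎

  -- θ-term x y k = z^k p^(k(k−1)/2) when x = z and y = p/z.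
  θ-term : Carrier → Carrier → ℤ → Carrier
  θ-term x y k = x ^ T k * y ^ T′ k

  module _ {x y p : Carrier} (xy≈p : x * y ≈ p) where

    p^-absorb : ∀ i a b → p ^ i * (x ^ a * y ^ b) ≈ x ^ (i ℕ.+ a) * y ^ (i ℕ.+ b)
    p^-absorb i a b = begin
      p ^ i * (x ^ a * y ^ b)             ≈⟨ *-congʳ (trans (^-congˡ i (sym xy≈p)) (^-distrib-* x y i)) ⟩
      (x ^ i * y ^ i) * (x ^ a * y ^ b)   ≈⟨ solve 4 (λ a b c d → (a :* b) :* (c :* d) := (a :* c) :* (b :* d)) refl _ _ _ _ ⟩
      (x ^ i * x ^ a) * (y ^ i * y ^ b)   ≈⟨ *-cong (^-homo-* x i a) (^-homo-* y i b) ⟨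
      x ^ (i ℕ.+ a) * y ^ (i ℕ.+ b) ∎

    -- The term at k - 1 is z⁻¹ p^(1-k) times the term at k. With k = i - b, the factor `p ^ i`
    -- clears the negative powers, and z⁻¹ p^(b+1) is `y * p ^ b`.
    θ-term-step : ∀ i b → p ^ i * θ-term x y (i ⊖ suc b) ≈ (y * p ^ b) * θ-term x y (i ⊖ b)
    θ-term-step i b = begin
      p ^ i * θ-term x y (i ⊖ suc b)
        ≈⟨ p^-absorb i _ _ ⟩
      x ^ (i ℕ.+ T (i ⊖ suc b)) * y ^ (i ℕ.+ T′ (i ⊖ suc b))
        ≈⟨ *-cong (^-congʳ x (T-step i b)) (^-congʳ y (T′-step i b)) ⟩
      x ^ (b ℕ.+ T (i ⊖ b)) * (y * y ^ (b ℕ.+ T′ (i ⊖ b)))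
        ≈⟨ solve 3 (λ a b c → a :* (b :* c) := b :* (a :* c)) refl _ _ _ ⟩
      y * (x ^ (b ℕ.+ T (i ⊖ b)) * y ^ (b ℕ.+ T′ (i ⊖ b)))
        ≈⟨ *-congˡ (p^-absorb b _ _) ⟨
      y * (p ^ b * θ-term x y (i ⊖ b))
        ≈⟨ *-assoc _ _ _ ⟨
      (y * p ^ b) * θ-term x y (i ⊖ b) ∎

    -- Cauchy's finite form of the triple product. The q-binomial theorem is the case without
    -- factors in `y`; each further factor `1# + y * p ^ b` moves the window of exponents i - b one
    -- place to the left.
    finite-triple-product : ∀ a b →
      ∏ a (λ i → 1# + x * p ^ i) * ∏ b (λ i → 1# + y * p ^ i)
        ≈ ∑ (suc (b ℕ.+ a)) (λ i → gaussian p (b ℕ.+ a) i * θ-term x y (i ⊖ b))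
    finite-triple-product a zero = trans (*-identityʳ _) (trans (q-binomial p a x)
      (∑-cong (suc a) λ i → *-congˡ {gaussian p a i} (begin
        x ^ i * p ^ T′ (+ i)          ≈⟨ *-congˡ (trans (^-congˡ (T′ (+ i)) (sym xy≈p)) (^-distrib-* x y (T′ (+ i)))) ⟩
        x ^ i * (x ^ T′ (+ i) * y ^ T′ (+ i))  ≈⟨ *-assoc _ _ _ ⟨
        (x ^ i * x ^ T′ (+ i)) * y ^ T′ (+ i)  ≈⟨ *-congʳ (trans (sym (^-homo-* x i _)) (^-congʳ x (≡.sym (triangle≡n+T′ i)))) ⟩
        x ^ triangle i * y ^ T′ (+ i) ∎)))
    finite-triple-product a (suc b) = begin
      ∏ a (λ i → 1# + x * p ^ i) * ∏ (suc b) (λ i → 1# + y * p ^ i)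
        ≈⟨ trans (*-congˡ (∏-snoc b _)) (sym (*-assoc _ _ _)) ⟩
      (∏ a (λ i → 1# + x * p ^ i) * ∏ b (λ i → 1# + y * p ^ i)) * (1# + y * p ^ b)
        ≈⟨ *-congʳ (finite-triple-product a b) ⟩
      ∑ (suc (b ℕ.+ a)) (λ i → gaussian p (b ℕ.+ a) i * θ-term x y (i ⊖ b)) * (1# + y * p ^ b)
        ≈⟨ ∑-*ʳ (suc (b ℕ.+ a)) (1# + y * p ^ b) (λ i → gaussian p (b ℕ.+ a) i * θ-term x y (i ⊖ b)) ⟩
      ∑ (suc (b ℕ.+ a)) (λ i → gaussian p (b ℕ.+ a) i * θ-term x y (i ⊖ b) * (1# + y * p ^ b))
        ≈⟨ ∑-cong (suc (b ℕ.+ a)) (λ i → trans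
             (solve 3 (λ g m q → g :* m :* (:1 :+ q) := g :* (m :+ q :* m)) refl (gaussian p (b ℕ.+ a) i) (θ-term x y (i ⊖ b)) (y * p ^ b))
             (*-congˡ (+-cong (reflexive (≡.cong (θ-term x y) (≡.sym (ℤₚ.[1+m]⊖[1+n]≡m⊖n i b)))) (sym (θ-term-step i b))))) ⟩
      ∑ (suc (b ℕ.+ a)) (λ i → gaussian p (b ℕ.+ a) i * (θ-term x y (suc i ⊖ suc b) + p ^ i * θ-term x y (i ⊖ suc b)))
        ≈⟨ ∑-gaussian p (b ℕ.+ a) (λ i → θ-term x y (i ⊖ suc b)) ⟨
      ∑ (suc (suc b ℕ.+ a)) (λ i → gaussian p (suc b ℕ.+ a) i * θ-term x y (i ⊖ suc b)) ∎

-- Products of two theta series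

sq : ℤ → ℕ
sq k = ∣ k ∣ ℕ.* ∣ k ∣

+sq : ∀ k → + sq k ≡ k ℤ.* k
+sq (+ n)    = ℤₚ.pos-* n n
+sq -[1+ n ] = ≡.refl

-- Twice a triangular number is a polynomial, so identities between the exponents are checked
-- on doubled values.
Doubled : ℕ → ℤ → Set
Doubled a A = + a ℤ.+ + a ≡ A

doubled-+ : ∀ a b {A B} → Doubled a A → Doubled b B → Doubled (a ℕ.+ b) (A ℤ.+ B)
doubled-+ a b ≡.refl ≡.refl = interchange (+ a) (+ b)
  where
  interchange : ∀ a b → (a ℤ.+ b) ℤ.+ (a ℤ.+ b) ≡ (a ℤ.+ a) ℤ.+ (b ℤ.+ b)
  interchange = solve-∀

doubled-sq : ∀ k → Doubled (sq k) (k ℤ.* k ℤ.+ k ℤ.* k)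
doubled-sq k = ≡.cong₂ ℤ._+_ (+sq k) (+sq k)

doubled-triangle : ∀ n → Doubled (triangle n) (+ n ℤ.* + n ℤ.+ + n)
doubled-triangle zero    = ≡.refl
doubled-triangle (suc n) = ≡.trans (doubled-+ (suc n) (triangle n) ≡.refl (doubled-triangle n)) (lemma (+ n))
  where
  lemma : ∀ n → ((+ 1 ℤ.+ n) ℤ.+ (+ 1 ℤ.+ n)) ℤ.+ (n ℤ.* n ℤ.+ n) ≡ (+ 1 ℤ.+ n) ℤ.* (+ 1 ℤ.+ n) ℤ.+ (+ 1 ℤ.+ n)
  lemma = solve-∀

doubled-T : ∀ k → Doubled (T k) (k ℤ.* k ℤ.+ k)
doubled-T (+ n)    = doubled-triangle n
doubled-T -[1+ n ] = ≡.trans (doubled-triangle n) (lemma (+ n))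
  where
  lemma : ∀ n → n ℤ.* n ℤ.+ n ≡ (ℤ.- (+ 1 ℤ.+ n)) ℤ.* (ℤ.- (+ 1 ℤ.+ n)) ℤ.+ (ℤ.- (+ 1 ℤ.+ n))
  lemma = solve-∀

doubled-T′ : ∀ k → Doubled (T′ k) (k ℤ.* k ℤ.- k)
doubled-T′ (+ zero)  = ≡.refl
doubled-T′ (+ suc n) = ≡.trans (doubled-triangle n) (lemma (+ n))
  where
  lemma : ∀ n → n ℤ.* n ℤ.+ n ≡ (+ 1 ℤ.+ n) ℤ.* (+ 1 ℤ.+ n) ℤ.- (+ 1 ℤ.+ n)
  lemma = solve-∀
doubled-T′ -[1+ n ] = ≡.trans (doubled-triangle (suc n)) (lemma (+ suc n))
  where
  lemma : ∀ n → n ℤ.* n ℤ.+ n ≡ (ℤ.- n) ℤ.* (ℤ.- n) ℤ.- (ℤ.- n)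
  lemma = solve-∀

doubled-injective : ∀ {a b A B} → Doubled a A → Doubled b B → A ≡ B → a ≡ b
doubled-injective {a} {b} ≡.refl ≡.refl e =
  ℕₚ.*-cancelʳ-≡ a b 2 (≡.trans (twice a) (≡.trans (ℤₚ.+-injective e) (≡.sym (twice b))))
  where
  twice : ∀ a → a ℕ.* 2 ≡ a ℕ.+ a
  twice a = ≡.trans (ℕₚ.*-comm a 2) (≡.cong (a ℕ.+_) (ℕₚ.+-identityʳ a))

module _ (j d : ℤ) where
  private
    k l l₋ : ℤ
    k  = j ℤ.+ d
    l  = (d ℤ.+ d) ℤ.- (j ℤ.+ d)
    l₋ = ℤ.pred (d ℤ.+ d) ℤ.- (j ℤ.+ d)

  -- These six identities compare exponents under the change of variables k = j + d, l = d - j (for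
  -- k + l even) or l = d - 1 - j (for k + l odd). The suffixes name the variable `b`, `Y` or `W` of
  -- `even-terms` and `odd-terms` whose exponent is compared; T k + T′ k = k² explains the simple
  -- shape of the first.
  even-b : ((T k ℕ.+ T′ k) ℕ.+ (T l ℕ.+ T′ l)) ≡ ((sq j ℕ.+ sq j) ℕ.+ (sq d ℕ.+ sq d))
  even-b = doubled-injective {((T k ℕ.+ T′ k) ℕ.+ (T l ℕ.+ T′ l))} {((sq j ℕ.+ sq j) ℕ.+ (sq d ℕ.+ sq d))}
    (doubled-+ ((T k ℕ.+ T′ k)) ((T l ℕ.+ T′ l)) (doubled-+ (T k) (T′ k) (doubled-T k) (doubled-T′ k)) (doubled-+ (T l) (T′ l) (doubled-T l) (doubled-T′ l)))
    (doubled-+ ((sq j ℕ.+ sq j)) ((sq d ℕ.+ sq d)) (doubled-+ (sq j) (sq j) (doubled-sq j) (doubled-sq j)) (doubled-+ (sq d) (sq d) (doubled-sq d) (doubled-sq d))) (goal j d)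
    where
    goal : ∀ j d → let k = j ℤ.+ d ; l = (d ℤ.+ d) ℤ.- (j ℤ.+ d) in
      (((k ℤ.* k ℤ.+ k) ℤ.+ (k ℤ.* k ℤ.- k)) ℤ.+ ((l ℤ.* l ℤ.+ l) ℤ.+ (l ℤ.* l ℤ.- l)))
        ≡ (((j ℤ.* j ℤ.+ j ℤ.* j) ℤ.+ (j ℤ.* j ℤ.+ j ℤ.* j)) ℤ.+ ((d ℤ.* d ℤ.+ d ℤ.* d) ℤ.+ (d ℤ.* d ℤ.+ d ℤ.* d)))
    goal = solve-∀

  even-Y : (T k ℕ.+ T l) ≡ (sq j ℕ.+ (T d ℕ.+ T d))
  even-Y = doubled-injective {(T k ℕ.+ T l)} {(sq j ℕ.+ (T d ℕ.+ T d))}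
    (doubled-+ (T k) (T l) (doubled-T k) (doubled-T l))
    (doubled-+ (sq j) ((T d ℕ.+ T d)) (doubled-sq j) (doubled-+ (T d) (T d) (doubled-T d) (doubled-T d))) (goal j d)
    where
    goal : ∀ j d → let k = j ℤ.+ d ; l = (d ℤ.+ d) ℤ.- (j ℤ.+ d) in
      ((k ℤ.* k ℤ.+ k) ℤ.+ (l ℤ.* l ℤ.+ l))
        ≡ ((j ℤ.* j ℤ.+ j ℤ.* j) ℤ.+ ((d ℤ.* d ℤ.+ d) ℤ.+ (d ℤ.* d ℤ.+ d)))
    goal = solve-∀

  even-W : (T′ k ℕ.+ T l) ≡ ((T′ j ℕ.+ T′ j) ℕ.+ sq d)
  even-W = doubled-injective {(T′ k ℕ.+ T l)} {((T′ j ℕ.+ T′ j) ℕ.+ sq d)}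
    (doubled-+ (T′ k) (T l) (doubled-T′ k) (doubled-T l))
    (doubled-+ ((T′ j ℕ.+ T′ j)) (sq d) (doubled-+ (T′ j) (T′ j) (doubled-T′ j) (doubled-T′ j)) (doubled-sq d)) (goal j d)
    where
    goal : ∀ j d → let k = j ℤ.+ d ; l = (d ℤ.+ d) ℤ.- (j ℤ.+ d) in
      ((k ℤ.* k ℤ.- k) ℤ.+ (l ℤ.* l ℤ.+ l))
        ≡ (((j ℤ.* j ℤ.- j) ℤ.+ (j ℤ.* j ℤ.- j)) ℤ.+ (d ℤ.* d ℤ.+ d ℤ.* d))
    goal = solve-∀

  odd-b : ((T k ℕ.+ T′ k) ℕ.+ (T l₋ ℕ.+ T′ l₋)) ≡ suc (((T j ℕ.+ T j) ℕ.+ (T j ℕ.+ T j)) ℕ.+ ((T′ d ℕ.+ T′ d) ℕ.+ (T′ d ℕ.+ T′ d)))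
  odd-b = doubled-injective {((T k ℕ.+ T′ k) ℕ.+ (T l₋ ℕ.+ T′ l₋))} {suc (((T j ℕ.+ T j) ℕ.+ (T j ℕ.+ T j)) ℕ.+ ((T′ d ℕ.+ T′ d) ℕ.+ (T′ d ℕ.+ T′ d)))}
    (doubled-+ ((T k ℕ.+ T′ k)) ((T l₋ ℕ.+ T′ l₋)) (doubled-+ (T k) (T′ k) (doubled-T k) (doubled-T′ k)) (doubled-+ (T l₋) (T′ l₋) (doubled-T l₋) (doubled-T′ l₋)))
    (doubled-+ 1 (((T j ℕ.+ T j) ℕ.+ (T j ℕ.+ T j)) ℕ.+ ((T′ d ℕ.+ T′ d) ℕ.+ (T′ d ℕ.+ T′ d))) ≡.refl (doubled-+ (((T j ℕ.+ T j) ℕ.+ (T j ℕ.+ T j))) (((T′ d ℕ.+ T′ d) ℕ.+ (T′ d ℕ.+ T′ d))) (doubled-+ ((T j ℕ.+ T j)) ((T j ℕ.+ T j)) (doubled-+ (T j) (T j) (doubled-T j) (doubled-T j)) (doubled-+ (T j) (T j) (doubled-T j) (doubled-T j))) (doubled-+ ((T′ d ℕ.+ T′ d)) ((T′ d ℕ.+ T′ d)) (doubled-+ (T′ d) (T′ d) (doubled-T′ d) (doubled-T′ d)) (doubled-+ (T′ d) (T′ d) (doubled-T′ d) (doubled-T′ d))))) (goal j d)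
    where
    goal : ∀ j d → let k = j ℤ.+ d ; l = (-[1+ 0 ] ℤ.+ (d ℤ.+ d)) ℤ.- (j ℤ.+ d) in
      (((k ℤ.* k ℤ.+ k) ℤ.+ (k ℤ.* k ℤ.- k)) ℤ.+ ((l ℤ.* l ℤ.+ l) ℤ.+ (l ℤ.* l ℤ.- l)))
        ≡ + 2 ℤ.+ ((((j ℤ.* j ℤ.+ j) ℤ.+ (j ℤ.* j ℤ.+ j)) ℤ.+ ((j ℤ.* j ℤ.+ j) ℤ.+ (j ℤ.* j ℤ.+ j))) ℤ.+ (((d ℤ.* d ℤ.- d) ℤ.+ (d ℤ.* d ℤ.- d)) ℤ.+ ((d ℤ.* d ℤ.- d) ℤ.+ (d ℤ.* d ℤ.- d))))
    goal = solve-∀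

  odd-Y : (T k ℕ.+ T l₋) ≡ ((T j ℕ.+ T j) ℕ.+ sq d)
  odd-Y = doubled-injective {(T k ℕ.+ T l₋)} {((T j ℕ.+ T j) ℕ.+ sq d)}
    (doubled-+ (T k) (T l₋) (doubled-T k) (doubled-T l₋))
    (doubled-+ ((T j ℕ.+ T j)) (sq d) (doubled-+ (T j) (T j) (doubled-T j) (doubled-T j)) (doubled-sq d)) (goal j d)
    where
    goal : ∀ j d → let k = j ℤ.+ d ; l = (-[1+ 0 ] ℤ.+ (d ℤ.+ d)) ℤ.- (j ℤ.+ d) in
      ((k ℤ.* k ℤ.+ k) ℤ.+ (l ℤ.* l ℤ.+ l))
        ≡ (((j ℤ.* j ℤ.+ j) ℤ.+ (j ℤ.* j ℤ.+ j)) ℤ.+ (d ℤ.* d ℤ.+ d ℤ.* d))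
    goal = solve-∀

  odd-W : (T′ k ℕ.+ T l₋) ≡ (sq j ℕ.+ (T′ d ℕ.+ T′ d))
  odd-W = doubled-injective {(T′ k ℕ.+ T l₋)} {(sq j ℕ.+ (T′ d ℕ.+ T′ d))}
    (doubled-+ (T′ k) (T l₋) (doubled-T′ k) (doubled-T l₋))
    (doubled-+ (sq j) ((T′ d ℕ.+ T′ d)) (doubled-sq j) (doubled-+ (T′ d) (T′ d) (doubled-T′ d) (doubled-T′ d))) (goal j d)
    where
    goal : ∀ j d → let k = j ℤ.+ d ; l = (-[1+ 0 ] ℤ.+ (d ℤ.+ d)) ℤ.- (j ℤ.+ d) in
      ((k ℤ.* k ℤ.- k) ℤ.+ (l ℤ.* l ℤ.+ l))
        ≡ ((j ℤ.* j ℤ.+ j ℤ.* j) ℤ.+ ((d ℤ.* d ℤ.- d) ℤ.+ (d ℤ.* d ℤ.- d)))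
    goal = solve-∀

n≤triangle : ∀ n → n ℕ.≤ triangle n
n≤triangle zero    = z≤n
n≤triangle (suc n) = ℕₚ.m≤m+n (suc n) (triangle n)

-- The bound loses one because T vanishes at -1 and T′ at 1. This is why the series below are
-- supported within `suc n` and not within `n`.
T-≥ : ∀ {n} k → suc n ℕ.≤ ∣ k ∣ → n ℕ.≤ T k
T-≥ (+ m)    n<m = ℕₚ.≤-trans (ℕₚ.<⇒≤ n<m) (n≤triangle m)
T-≥ -[1+ m ] (s≤s n≤m) = ℕₚ.≤-trans n≤m (n≤triangle m)

T′-≥ : ∀ {n} k → suc n ℕ.≤ ∣ k ∣ → n ℕ.≤ T′ k
T′-≥ (+ suc m)  (s≤s n≤m) = ℕₚ.≤-trans n≤m (n≤triangle m)
T′-≥ -[1+ m ]   n<m = ℕₚ.≤-trans (ℕₚ.<⇒≤ n<m) (n≤triangle (suc m))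

sq-≥ : ∀ {n} k → suc n ℕ.≤ ∣ k ∣ → n ℕ.≤ sq k
sq-≥ k n<k with ∣ k ∣ | n<k
... | suc m | s≤s n≤m = ℕₚ.≤-trans n≤m (ℕₚ.≤-trans (ℕₚ.n≤1+n m) (ℕₚ.m≤m*n (suc m) (suc m)))

below-window : ∀ B s → B ℕ.≤ ∣ ℤ.- (+ B ℤ.+ + suc s) ∣
below-window B s rewrite ℤₚ.∣-i∣≡∣i∣ (+ B ℤ.+ + suc s) = ℕₚ.m≤m+n B (suc s)

-- Bilateral sums over finite windows of integers

module Bilateral {c ℓ} (R : CommutativeRing c ℓ) where
  open TripleProduct R public

  S : ℤ → ℕ → (ℤ → Carrier) → Carrier
  S a N f = ∑ N λ i → f (a ℤ.+ + i)

  S-cong : ∀ a N {f g : ℤ → Carrier} → (∀ k → f k ≈ g k) → S a N f ≈ S a N g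
  S-cong a N h = ∑-cong N λ i → h _

  S-translate : ∀ a N c (f : ℤ → Carrier) → S a N (λ k → f (k ℤ.+ c)) ≈ S (a ℤ.+ c) N f
  S-translate a N c f = ∑-cong N λ i → reflexive (≡.cong f (lemma a (+ i) c))
    where
    lemma : ∀ a i c → (a ℤ.+ i) ℤ.+ c ≡ (a ℤ.+ c) ℤ.+ i
    lemma = solve-∀

  S-double : ∀ a N (f : ℤ → Carrier) →
    S (a ℤ.+ a) (N ℕ.+ N) f ≈ S a N (λ k → f (k ℤ.+ k) + f (+ 1 ℤ.+ (k ℤ.+ k)))
  S-double a N f = trans (∑-double N (λ i → f ((a ℤ.+ a) ℤ.+ + i))) (∑-cong N λ i →
    reflexive (≡.cong₂ (λ u v → f u + f v) (lemma₀ a (+ i)) (lemma₁ a (+ i))))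
    where
    lemma₀ : ∀ a i → (a ℤ.+ a) ℤ.+ (i ℤ.+ i) ≡ (a ℤ.+ i) ℤ.+ (a ℤ.+ i)
    lemma₀ = solve-∀
    lemma₁ : ∀ a i → (a ℤ.+ a) ℤ.+ (+ 1 ℤ.+ (i ℤ.+ i)) ≡ + 1 ℤ.+ ((a ℤ.+ i) ℤ.+ (a ℤ.+ i))
    lemma₁ = solve-∀

  S-*ˡ : ∀ a N u (f : ℤ → Carrier) → u * S a N f ≈ S a N (λ k → u * f k)
  S-*ˡ a N u f = ∑-*ˡ N u _

  S-+ : ∀ a N (f g : ℤ → Carrier) → S a N (λ k → f k + g k) ≈ S a N f + S a N g
  S-+ a N f g = ∑-+ N _ _

  S-swap : ∀ a M b N (f : ℤ → ℤ → Carrier) →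
    S a M (λ k → S b N (f k)) ≈ S b N (λ l → S a M (λ k → f k l))
  S-swap a M b N f = ∑-swap M N λ i j → f (a ℤ.+ + i) (b ℤ.+ + j)

  S-* : ∀ a M b N (f g : ℤ → Carrier) →
    S a M f * S b N g ≈ S a M (λ k → S b N (λ l → f k * g l))
  S-* a M b N f g = trans (∑-*ʳ M _ _) (∑-cong M λ i → ∑-*ˡ N _ _)

  Supported : ℕ → (ℤ → Carrier) → Set ℓ
  Supported B f = ∀ k → B ℕ.≤ ∣ k ∣ → f k ≈ 0#

  S₀ : ℕ → (ℤ → Carrier) → Carrier
  S₀ B = S (ℤ.- + B) (B ℕ.+ B)

  -- A window may overhang the support by `m` places on the left and `r` on the right. Windows can
  -- therefore be chosen generously when summation variables are changed, and be shrunk afterwards.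
  S-window : ∀ {B f} → Supported B f → ∀ m r {a N} →
    a ≡ ℤ.- (+ B ℤ.+ + m) → N ≡ m ℕ.+ ((B ℕ.+ B) ℕ.+ r) → S a N f ≈ S₀ B f
  S-window {B} {f} supp m r ≡.refl ≡.refl = begin
    ∑ (m ℕ.+ ((B ℕ.+ B) ℕ.+ r)) F
      ≈⟨ ∑-split m _ F ⟩
    ∑ m F + ∑ ((B ℕ.+ B) ℕ.+ r) (λ i → F (m ℕ.+ i))
      ≈⟨ +-cong (∑-0 m left) (∑-split (B ℕ.+ B) r _) ⟩
    0# + (∑ (B ℕ.+ B) (λ i → F (m ℕ.+ i)) + ∑ r (λ i → F (m ℕ.+ ((B ℕ.+ B) ℕ.+ i))))
      ≈⟨ trans (+-identityˡ _) (+-cong (∑-cong (B ℕ.+ B) λ i → reflexive (≡.cong f (middle (+ B) (+ m) (+ i)))) (∑-0 r right)) ⟩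
    S₀ B f + 0#
      ≈⟨ +-identityʳ _ ⟩
    S₀ B f ∎
    where
    F : ℕ → Carrier
    F i = f (ℤ.- (+ B ℤ.+ + m) ℤ.+ + i)
    middle : ∀ B m i → ℤ.- (B ℤ.+ m) ℤ.+ (m ℤ.+ i) ≡ ℤ.- B ℤ.+ i
    middle = solve-∀
    left : ∀ i → i ℕ.< m → F i ≈ 0#
    left i i<m = supp _ (≡.subst (λ k → B ℕ.≤ ∣ k ∣) eq (below-window B (m ℕ.∸ suc i)))
      where
      lemma : ∀ B i s → ℤ.- (B ℤ.+ (+ 1 ℤ.+ s)) ≡ ℤ.- (B ℤ.+ ((+ 1 ℤ.+ i) ℤ.+ s)) ℤ.+ i
      lemma = solve-∀
      eq : ℤ.- (+ B ℤ.+ + suc (m ℕ.∸ suc i)) ≡ ℤ.- (+ B ℤ.+ + m) ℤ.+ + i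
      eq = ≡.trans (lemma (+ B) (+ i) (+ (m ℕ.∸ suc i)))
        (≡.cong (λ t → ℤ.- (+ B ℤ.+ + t) ℤ.+ + i) (ℕₚ.m+[n∸m]≡n i<m))
    right : ∀ i → i ℕ.< r → F (m ℕ.+ ((B ℕ.+ B) ℕ.+ i)) ≈ 0#
    right i _ = supp _ (≡.subst (λ k → B ℕ.≤ ∣ k ∣) (lemma (+ B) (+ m) (+ i)) (ℕₚ.m≤m+n B i))
      where
      lemma : ∀ B m i → B ℤ.+ i ≡ ℤ.- (B ℤ.+ m) ℤ.+ (m ℤ.+ ((B ℤ.+ B) ℤ.+ i))
      lemma = solve-∀

  -- The pairs (k , l) are regrouped by the parity of k + l, which is 2d or 2d − 1, and by j = k − d.
  S₀-product : ∀ B {g h : ℤ → Carrier} → Supported B g → Supported B h →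
    S₀ B g * S₀ B h ≈
      S (ℤ.- (+ B ℤ.+ + B)) (B ℕ.+ ((B ℕ.+ B) ℕ.+ B)) λ d →
      S (ℤ.- (+ B ℤ.+ + (B ℕ.+ B))) ((B ℕ.+ B) ℕ.+ ((B ℕ.+ B) ℕ.+ (B ℕ.+ B))) λ j →
        g (j ℤ.+ d) * h ((d ℤ.+ d) ℤ.- (j ℤ.+ d)) + g (j ℤ.+ d) * h (ℤ.pred (d ℤ.+ d) ℤ.- (j ℤ.+ d))
  S₀-product B {g} {h} supp-g supp-h = begin
    S₀ B g * S₀ B h
      ≈⟨ S-* (ℤ.- + B) (B ℕ.+ B) (ℤ.- + B) (B ℕ.+ B) g h ⟩
    S₀ B (λ k → S₀ B (λ l → g k * h l))
      ≈⟨ ∑-cong< (B ℕ.+ B) (λ i i<2B → shear i i<2B) ⟨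
    S₀ B (λ k → S a N (λ t → g k * h (t ℤ.- k)))
      ≈⟨ S-swap (ℤ.- + B) (B ℕ.+ B) a N (λ k t → g k * h (t ℤ.- k)) ⟩
    S a N diagonal
      -- Starting the window at 2D - 1 makes `S-double` pair t = 2d - 1 with t = 2d.
      ≈⟨ ∑-cong N (λ i → reflexive (≡.cong (λ a′ → diagonal (a′ ℤ.+ + i)) (a≡ (+ B)))) ⟩
    S ((D ℤ.+ D) ℤ.- + 1) (M ℕ.+ M) diagonal
      ≈⟨ S-translate (D ℤ.+ D) (M ℕ.+ M) (ℤ.- + 1) diagonal ⟨
    S (D ℤ.+ D) (M ℕ.+ M) (λ t → diagonal (t ℤ.- + 1))
      ≈⟨ S-double D M (λ t → diagonal (t ℤ.- + 1)) ⟩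
    S D M (λ d → diagonal ((d ℤ.+ d) ℤ.- + 1) + diagonal ((+ 1 ℤ.+ (d ℤ.+ d)) ℤ.- + 1))
      ≈⟨ S-cong D M (λ d → trans (+-comm _ _)
           (+-cong (reflexive (≡.cong diagonal (1+t-1 (d ℤ.+ d)))) (reflexive (≡.cong diagonal (ℤₚ.+-comm (d ℤ.+ d) (ℤ.- + 1)))))) ⟩
    S D M (λ d → diagonal (d ℤ.+ d) + diagonal (ℤ.pred (d ℤ.+ d)))
      ≈⟨ ∑-cong< M (λ i i<M → trans (sym (+-cong (recentre i i<M (double (D ℤ.+ + i))) (recentre i i<M (ℤ.pred (double (D ℤ.+ + i)))))) (sym (S-+ J L (term double (D ℤ.+ + i)) (term (ℤ.pred ∘ double) (D ℤ.+ + i))))) ⟩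
    S D M (λ d → S J L (λ j →
        g (j ℤ.+ d) * h ((d ℤ.+ d) ℤ.- (j ℤ.+ d)) + g (j ℤ.+ d) * h (ℤ.pred (d ℤ.+ d) ℤ.- (j ℤ.+ d)))) ∎
    where
    double : ℤ → ℤ
    double d = d ℤ.+ d
    term : (ℤ → ℤ) → ℤ → ℤ → Carrier
    term t d j = g (j ℤ.+ d) * h (t d ℤ.- (j ℤ.+ d))
    -- With d in [-2B, 2B), the values 2d - 1 and 2d fill the window [-4B - 1, 4B - 1) of t = k + l,
    -- which still covers [-B, B) after translation by -k. The window [-3B, 3B) of j covers [-B, B)
    -- after translation by any such d.
    D J a : ℤ
    D = ℤ.- (+ B ℤ.+ + B)
    J = ℤ.- (+ B ℤ.+ + (B ℕ.+ B))
    a = ℤ.- (+ B ℤ.+ (+ B ℤ.+ + B) ℤ.+ + B ℤ.+ + 1)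
    M L N : ℕ
    M = B ℕ.+ ((B ℕ.+ B) ℕ.+ B)
    L = (B ℕ.+ B) ℕ.+ ((B ℕ.+ B) ℕ.+ (B ℕ.+ B))
    N = M ℕ.+ M
    a≡ : ∀ B → ℤ.- (B ℤ.+ (B ℤ.+ B) ℤ.+ B ℤ.+ + 1) ≡ (ℤ.- (B ℤ.+ B) ℤ.+ ℤ.- (B ℤ.+ B)) ℤ.- + 1
    a≡ = solve-∀
    1+t-1 : ∀ t → (+ 1 ℤ.+ t) ℤ.- + 1 ≡ t
    1+t-1 = solve-∀
    diagonal : ℤ → Carrier
    diagonal t = S₀ B (λ k → g k * h (t ℤ.- k))
    shear : ∀ i → i ℕ.< B ℕ.+ B → let k = ℤ.- + B ℤ.+ + i in
      S a N (λ t → g k * h (t ℤ.- k)) ≈ S₀ B (λ l → g k * h l)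
    shear i i<2B = trans (S-translate a N (ℤ.- k) (λ l → g k * h l))
      (S-window (λ l B≤l → trans (*-congˡ (supp-h l B≤l)) (zeroʳ _))
        (suc (B ℕ.+ B ℕ.+ i)) ((B ℕ.+ B) ℕ.+ r) (origin (+ B) (+ i)) (length B i r (ℕₚ.m+[n∸m]≡n i<2B)))
      where
      k = ℤ.- + B ℤ.+ + i
      r = (B ℕ.+ B) ℕ.∸ suc i
      origin : ∀ B i → ℤ.- (B ℤ.+ (B ℤ.+ B) ℤ.+ B ℤ.+ + 1) ℤ.+ ℤ.- (ℤ.- B ℤ.+ i)
        ≡ ℤ.- (B ℤ.+ (+ 1 ℤ.+ ((B ℤ.+ B) ℤ.+ i)))
      origin = solve-∀
      length : ∀ B i r → suc i ℕ.+ r ≡ B ℕ.+ B →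
        (B ℕ.+ ((B ℕ.+ B) ℕ.+ B)) ℕ.+ (B ℕ.+ ((B ℕ.+ B) ℕ.+ B)) ≡ suc (B ℕ.+ B ℕ.+ i) ℕ.+ ((B ℕ.+ B) ℕ.+ ((B ℕ.+ B) ℕ.+ r))
      length B i r e = ≡.trans (lemma₁ B) (≡.trans (≡.cong (λ t → ((B ℕ.+ B) ℕ.+ ((B ℕ.+ B) ℕ.+ (B ℕ.+ B))) ℕ.+ t) (≡.sym e)) (lemma₂ (B ℕ.+ B) i r))
        where
        lemma₁ : ∀ B → (B ℕ.+ ((B ℕ.+ B) ℕ.+ B)) ℕ.+ (B ℕ.+ ((B ℕ.+ B) ℕ.+ B)) ≡ ((B ℕ.+ B) ℕ.+ ((B ℕ.+ B) ℕ.+ (B ℕ.+ B))) ℕ.+ (B ℕ.+ B)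
        lemma₁ = ℕ-Solver.solve-∀
        lemma₂ : ∀ b i r → (b ℕ.+ (b ℕ.+ b)) ℕ.+ (suc i ℕ.+ r) ≡ suc (b ℕ.+ i) ℕ.+ (b ℕ.+ (b ℕ.+ r))
        lemma₂ = ℕ-Solver.solve-∀
    recentre : ∀ i → i ℕ.< M → ∀ t → let d = D ℤ.+ + i in
      S J L (λ j → g (j ℤ.+ d) * h (t ℤ.- (j ℤ.+ d))) ≈ diagonal t
    recentre i i<M t = trans (S-translate J L (D ℤ.+ + i) (λ k → g k * h (t ℤ.- k)))
      (S-window (λ k B≤k → trans (*-congʳ (supp-g k B≤k)) (zeroˡ (h (t ℤ.- k))))
        m i (origin B m i (ℕₚ.m∸n+n≡m i≤M))
          (length B m i (ℕₚ.m∸n+n≡m i≤M)))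
      where
      i≤M = ℕₚ.<⇒≤ i<M
      m = M ℕ.∸ i
      origin : ∀ B m i → m ℕ.+ i ≡ B ℕ.+ ((B ℕ.+ B) ℕ.+ B) →
        ℤ.- (+ B ℤ.+ + (B ℕ.+ B)) ℤ.+ (ℤ.- + (B ℕ.+ B) ℤ.+ + i) ≡ ℤ.- (+ B ℤ.+ + m)
      origin B m i e = ≡.trans (lemma₁ (+ B) (+ i)) (≡.trans (≡.cong (λ t → ℤ.- (+ B ℤ.+ (+ t ℤ.- + i))) (≡.sym e)) (lemma₂ (+ B) (+ m) (+ i)))
        where
        lemma₁ : ∀ B i → ℤ.- (B ℤ.+ (B ℤ.+ B)) ℤ.+ (ℤ.- (B ℤ.+ B) ℤ.+ i) ≡ ℤ.- (B ℤ.+ ((B ℤ.+ ((B ℤ.+ B) ℤ.+ B)) ℤ.- i))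
        lemma₁ = solve-∀
        lemma₂ : ∀ B m i → ℤ.- (B ℤ.+ ((m ℤ.+ i) ℤ.- i)) ≡ ℤ.- (B ℤ.+ m)
        lemma₂ = solve-∀
      length : ∀ B m i → m ℕ.+ i ≡ B ℕ.+ ((B ℕ.+ B) ℕ.+ B) →
        (B ℕ.+ B) ℕ.+ ((B ℕ.+ B) ℕ.+ (B ℕ.+ B)) ≡ m ℕ.+ ((B ℕ.+ B) ℕ.+ i)
      length B m i e = ≡.trans (lemma₁ B) (≡.trans (≡.cong ((B ℕ.+ B) ℕ.+_) (≡.sym e)) (lemma₂ (B ℕ.+ B) m i))
        where
        lemma₁ : ∀ B → (B ℕ.+ B) ℕ.+ ((B ℕ.+ B) ℕ.+ (B ℕ.+ B)) ≡ (B ℕ.+ B) ℕ.+ (B ℕ.+ ((B ℕ.+ B) ℕ.+ B))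
        lemma₁ = ℕ-Solver.solve-∀
        lemma₂ : ∀ b m i → b ℕ.+ (m ℕ.+ i) ≡ m ℕ.+ (b ℕ.+ i)
        lemma₂ = ℕ-Solver.solve-∀

-- Theta series as determinants, and Weierstrass's three-term relation

module ThetaRelations {c ℓ} (R : CommutativeRing c ℓ) where
  open Bilateral R public

  -- For X X′ = p these are X^k p^(k²) and X^k p^(k²−k).
  e-term o-term : Carrier → Carrier → ℤ → Carrier
  e-term X X′ k = X ^ (T k ℕ.+ T k) * X′ ^ sq k
  o-term X X′ k = X′ ^ (T′ k ℕ.+ T′ k) * X ^ sq k

  private
    square-^ : ∀ b Y s → (b * b * Y) ^ s ≈ b ^ (s ℕ.+ s) * Y ^ s
    square-^ b Y s = trans (^-distrib-* (b * b) Y s)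
      (*-congʳ (trans (^-distrib-* b b s) (sym (^-homo-* b s s))))

    collect : ∀ b Y W a a′ s s′ →
      ((b * Y) ^ a * (b * W) ^ a′) * ((b * Y * W) ^ s * b ^ s′)
        ≈ b ^ ((a ℕ.+ a′) ℕ.+ (s ℕ.+ s′)) * (Y ^ (a ℕ.+ s) * W ^ (a′ ℕ.+ s))
    collect b Y W a a′ s s′ = begin
      ((b * Y) ^ a * (b * W) ^ a′) * ((b * Y * W) ^ s * b ^ s′)
        ≈⟨ *-cong (*-cong (^-distrib-* b Y a) (^-distrib-* b W a′))
             (*-congʳ (trans (^-distrib-* (b * Y) W s) (*-congʳ (^-distrib-* b Y s)))) ⟩
      ((b ^ a * Y ^ a) * (b ^ a′ * W ^ a′)) * (((b ^ s * Y ^ s) * W ^ s) * b ^ s′)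
        ≈⟨ solve 8 (λ ba Ya ba′ Wa′ bs Ys Ws bs′ →
             ((ba :* Ya) :* (ba′ :* Wa′)) :* (((bs :* Ys) :* Ws) :* bs′)
               := ((ba :* ba′) :* (bs :* bs′)) :* ((Ya :* Ys) :* (Wa′ :* Ws)))
             refl _ _ _ _ _ _ _ _ ⟩
      ((b ^ a * b ^ a′) * (b ^ s * b ^ s′)) * ((Y ^ a * Y ^ s) * (W ^ a′ * W ^ s))
        ≈⟨ *-cong (trans (^-homo-* b (a ℕ.+ a′) _) (*-cong (^-homo-* b a a′) (^-homo-* b s s′)))
             (*-cong (^-homo-* Y a s) (^-homo-* W a′ s)) ⟨
      b ^ ((a ℕ.+ a′) ℕ.+ (s ℕ.+ s′)) * (Y ^ (a ℕ.+ s) * W ^ (a′ ℕ.+ s)) ∎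

    spread : ∀ b Y W s t u v →
      ((b * b * Y) ^ s * W ^ u) * ((b * b * W) ^ v * Y ^ t)
        ≈ b ^ ((s ℕ.+ s) ℕ.+ (v ℕ.+ v)) * (Y ^ (s ℕ.+ t) * W ^ (u ℕ.+ v))
    spread b Y W s t u v = begin
      ((b * b * Y) ^ s * W ^ u) * ((b * b * W) ^ v * Y ^ t)
        ≈⟨ *-cong (*-congʳ (square-^ b Y s)) (*-congʳ (square-^ b W v)) ⟩
      ((b ^ (s ℕ.+ s) * Y ^ s) * W ^ u) * ((b ^ (v ℕ.+ v) * W ^ v) * Y ^ t)
        ≈⟨ solve 6 (λ bs Ys Wu bv Wv Yt → ((bs :* Ys) :* Wu) :* ((bv :* Wv) :* Yt)
             := (bs :* bv) :* ((Ys :* Yt) :* (Wu :* Wv))) refl _ _ _ _ _ _ ⟩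
      (b ^ (s ℕ.+ s) * b ^ (v ℕ.+ v)) * ((Y ^ s * Y ^ t) * (W ^ u * W ^ v))
        ≈⟨ *-cong (^-homo-* b (s ℕ.+ s) (v ℕ.+ v)) (*-cong (^-homo-* Y s t) (^-homo-* W u v)) ⟨
      b ^ ((s ℕ.+ s) ℕ.+ (v ℕ.+ v)) * (Y ^ (s ℕ.+ t) * W ^ (u ℕ.+ v)) ∎

  module _ (b Y W : Carrier) (j d : ℤ) where

    -- Both sides are monomials in the independent variables `b`, `Y`, `W`, so comparing three
    -- exponents suffices. The right side separates j from d, which makes the double sum a product.
    even-terms : θ-term (b * Y) (b * W) (j ℤ.+ d) * θ-term (b * Y * W) b ((d ℤ.+ d) ℤ.- (j ℤ.+ d))
      ≈ o-term (b * b * Y) W j * e-term Y (b * b * W) d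
    even-terms = begin
      θ-term (b * Y) (b * W) k * θ-term (b * Y * W) b l
        ≈⟨ collect b Y W (T k) (T′ k) (T l) (T′ l) ⟩
      b ^ ((T k ℕ.+ T′ k) ℕ.+ (T l ℕ.+ T′ l)) * (Y ^ (T k ℕ.+ T l) * W ^ (T′ k ℕ.+ T l))
        ≈⟨ *-cong (^-congʳ b (even-b j d)) (*-cong (^-congʳ Y (even-Y j d)) (^-congʳ W (even-W j d))) ⟩
      b ^ ((sq j ℕ.+ sq j) ℕ.+ (sq d ℕ.+ sq d)) * (Y ^ (sq j ℕ.+ (T d ℕ.+ T d)) * W ^ ((T′ j ℕ.+ T′ j) ℕ.+ sq d))
        ≈⟨ spread b Y W (sq j) (T d ℕ.+ T d) (T′ j ℕ.+ T′ j) (sq d) ⟨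
      ((b * b * Y) ^ sq j * W ^ (T′ j ℕ.+ T′ j)) * ((b * b * W) ^ sq d * Y ^ (T d ℕ.+ T d))
        ≈⟨ *-cong (*-comm _ _) (*-comm _ _) ⟩
      o-term (b * b * Y) W j * e-term Y (b * b * W) d ∎
      where
      k l : ℤ
      k = j ℤ.+ d
      l = (d ℤ.+ d) ℤ.- (j ℤ.+ d)

    odd-terms : θ-term (b * Y) (b * W) (j ℤ.+ d) * θ-term (b * Y * W) b (ℤ.pred (d ℤ.+ d) ℤ.- (j ℤ.+ d))
      ≈ b * (e-term (b * b * Y) W j * o-term Y (b * b * W) d)
    odd-terms = begin
      θ-term (b * Y) (b * W) k * θ-term (b * Y * W) b l
        ≈⟨ collect b Y W (T k) (T′ k) (T l) (T′ l) ⟩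
      b ^ ((T k ℕ.+ T′ k) ℕ.+ (T l ℕ.+ T′ l)) * (Y ^ (T k ℕ.+ T l) * W ^ (T′ k ℕ.+ T l))
        ≈⟨ *-cong (^-congʳ b (odd-b j d)) (*-cong (^-congʳ Y (odd-Y j d)) (^-congʳ W (odd-W j d))) ⟩
      (b * b ^ (((T j ℕ.+ T j) ℕ.+ (T j ℕ.+ T j)) ℕ.+ ((T′ d ℕ.+ T′ d) ℕ.+ (T′ d ℕ.+ T′ d)))) * (Y ^ ((T j ℕ.+ T j) ℕ.+ sq d) * W ^ (sq j ℕ.+ (T′ d ℕ.+ T′ d)))
        ≈⟨ *-assoc b _ _ ⟩
      b * (b ^ (((T j ℕ.+ T j) ℕ.+ (T j ℕ.+ T j)) ℕ.+ ((T′ d ℕ.+ T′ d) ℕ.+ (T′ d ℕ.+ T′ d))) * (Y ^ ((T j ℕ.+ T j) ℕ.+ sq d) * W ^ (sq j ℕ.+ (T′ d ℕ.+ T′ d))))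
        ≈⟨ *-congˡ (spread b Y W (T j ℕ.+ T j) (sq d) (sq j) (T′ d ℕ.+ T′ d)) ⟨
      b * (e-term (b * b * Y) W j * o-term Y (b * b * W) d) ∎
      where
      k l : ℤ
      k = j ℤ.+ d
      l = ℤ.pred (d ℤ.+ d) ℤ.- (j ℤ.+ d)

  module Nilpotent {p : Carrier} (n : ℕ) (pⁿ≈0 : p ^ n ≈ 0#) where

    monomial-0 : ∀ {x y a b} → x * y ≈ p → n ℕ.≤ a → n ℕ.≤ b → x ^ a * y ^ b ≈ 0#
    monomial-0 {x} {y} {a} {b} xy≈p n≤a n≤b = begin
      x ^ a * y ^ b
        ≈⟨ *-cong (^-congʳ x (ℕₚ.m+[n∸m]≡n n≤a)) (^-congʳ y (ℕₚ.m+[n∸m]≡n n≤b)) ⟨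
      x ^ (n ℕ.+ (a ℕ.∸ n)) * y ^ (n ℕ.+ (b ℕ.∸ n))  ≈⟨ p^-absorb xy≈p n _ _ ⟨
      p ^ n * (x ^ (a ℕ.∸ n) * y ^ (b ℕ.∸ n))        ≈⟨ trans (*-congʳ pⁿ≈0) (zeroˡ _) ⟩
      0# ∎

    θ-supported : ∀ {x y} → x * y ≈ p → Supported (suc n) (θ-term x y)
    θ-supported xy≈p k n<k = monomial-0 xy≈p (T-≥ k n<k) (T′-≥ k n<k)

    e-supported : ∀ {X X′} → X * X′ ≈ p → Supported (suc n) (e-term X X′)
    e-supported XX′≈p k n<k = monomial-0 XX′≈p (ℕₚ.≤-trans (T-≥ k n<k) (ℕₚ.m≤m+n _ _)) (sq-≥ k n<k)

    o-supported : ∀ {X X′} → X * X′ ≈ p → Supported (suc n) (o-term X X′)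
    o-supported XX′≈p k n<k = monomial-0 (trans (*-comm _ _) XX′≈p) (ℕₚ.≤-trans (T′-≥ k n<k) (ℕₚ.m≤m+n _ _)) (sq-≥ k n<k)

    θ-sum e o : Carrier → Carrier → Carrier
    θ-sum x y = S₀ (suc n) (θ-term x y)
    e X X′    = S₀ (suc n) (e-term X X′)
    o X X′    = S₀ (suc n) (o-term X X′)

    e-cong : ∀ {X X′ Z Z′} → X ≈ Z → X′ ≈ Z′ → e X X′ ≈ e Z Z′
    e-cong X≈Z X′≈Z′ = S-cong (ℤ.- + suc n) (suc n ℕ.+ suc n) λ k → *-cong (^-congˡ (T k ℕ.+ T k) X≈Z) (^-congˡ (sq k) X′≈Z′)

    o-cong : ∀ {X X′ Z Z′} → X ≈ Z → X′ ≈ Z′ → o X X′ ≈ o Z Z′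
    o-cong X≈Z X′≈Z′ = S-cong (ℤ.- + suc n) (suc n ℕ.+ suc n) λ k → *-cong (^-congˡ (T′ k ℕ.+ T′ k) X′≈Z′) (^-congˡ (sq k) X≈Z)

    -- For each parity of k + l the double sum over j and d splits into a product of single sums.
    -- The even part gives the first product and the odd part the second, with the factor `b` left
    -- over in `odd-terms`.
    θ-sum-product : ∀ b Y W → b * b * Y * W ≈ p →
      θ-sum (b * Y) (b * W) * θ-sum (b * Y * W) b
        ≈ o (b * b * Y) W * e Y (b * b * W) + b * (e (b * b * Y) W * o Y (b * b * W))
    θ-sum-product b Y W bbYW≈p = begin
      θ-sum (b * Y) (b * W) * θ-sum (b * Y * W) b
        ≈⟨ S₀-product B (θ-supported x₁y₁)
             (θ-supported x₂y₂) ⟩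
      S D M (λ d → S J L (λ j → g (j ℤ.+ d) * h ((d ℤ.+ d) ℤ.- (j ℤ.+ d)) + g (j ℤ.+ d) * h (ℤ.pred (d ℤ.+ d) ℤ.- (j ℤ.+ d))))
        ≈⟨ S-cong D M (λ d → S-cong J L (λ j → +-cong (even-terms b Y W j d) (odd-terms b Y W j d))) ⟩
      S D M (λ d → S J L (λ j → oX j * eY d + b * (eX j * oY d)))
        ≈⟨ S-swap D M J L (λ d j → oX j * eY d + b * (eX j * oY d)) ⟩
      S J L (λ j → S D M (λ d → oX j * eY d + b * (eX j * oY d)))
        ≈⟨ S-cong J L (λ j → trans (S-+ D M (λ d → oX j * eY d) (λ d → b * (eX j * oY d))) (+-congˡ (sym (S-*ˡ D M b (λ d → eX j * oY d))))) ⟩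
      S J L (λ j → S D M (λ d → oX j * eY d) + b * S D M (λ d → eX j * oY d))
        ≈⟨ trans (S-+ J L (λ j → S D M (λ d → oX j * eY d)) (λ j → b * S D M (λ d → eX j * oY d)))
             (+-congˡ (sym (S-*ˡ J L b (λ j → S D M (λ d → eX j * oY d))))) ⟩
      S J L (λ j → S D M (λ d → oX j * eY d)) + b * S J L (λ j → S D M (λ d → eX j * oY d))
        ≈⟨ +-cong (S-* J L D M oX eY) (*-congˡ (S-* J L D M eX oY)) ⟨
      S J L oX * S D M eY + b * (S J L eX * S D M oY)
        ≈⟨ +-cong (*-cong (wide (o-supported XW)) (narrow (e-supported YW)))
             (*-congˡ (*-cong (wide (e-supported XW)) (narrow (o-supported YW)))) ⟩
      o (b * b * Y) W * e Y (b * b * W) + b * (e (b * b * Y) W * o Y (b * b * W)) ∎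
      where
      B M L : ℕ
      B = suc n
      M = B ℕ.+ ((B ℕ.+ B) ℕ.+ B)
      L = (B ℕ.+ B) ℕ.+ ((B ℕ.+ B) ℕ.+ (B ℕ.+ B))
      D J : ℤ
      D = ℤ.- (+ B ℤ.+ + B)
      J = ℤ.- (+ B ℤ.+ + (B ℕ.+ B))
      g h oX eX oY eY : ℤ → Carrier
      g = θ-term (b * Y) (b * W)
      h = θ-term (b * Y * W) b
      oX = o-term (b * b * Y) W
      eX = e-term (b * b * Y) W
      oY = o-term Y (b * b * W)
      eY = e-term Y (b * b * W)
      x₁y₁ : (b * Y) * (b * W) ≈ p
      x₁y₁ = trans (solve 3 (λ b Y W → (b :* Y) :* (b :* W) := b :* b :* Y :* W) refl b Y W) bbYW≈p
      x₂y₂ : (b * Y * W) * b ≈ p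
      x₂y₂ = trans (solve 3 (λ b Y W → (b :* Y :* W) :* b := b :* b :* Y :* W) refl b Y W) bbYW≈p
      XW : (b * b * Y) * W ≈ p
      XW = bbYW≈p
      YW : Y * (b * b * W) ≈ p
      YW = trans (solve 3 (λ b Y W → Y :* (b :* b :* W) := b :* b :* Y :* W) refl b Y W) bbYW≈p
      wide : ∀ {f} → Supported B f → S J L f ≈ S₀ B f
      wide supp = S-window supp (B ℕ.+ B) (B ℕ.+ B) ≡.refl ≡.refl
      narrow : ∀ {f} → Supported B f → S D M f ≈ S₀ B f
      narrow supp = S-window supp B B ≡.refl ≡.refl

    -- Modulo `p ^ n` the middle Gaussian coefficient is 1/(p; p)_∞, the factor of Jacobi's identity
    -- that depends on p only. It enters every term of `weierstrass` to the fourth power.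
    C : Carrier
    C = gaussian p (n ℕ.+ n) n

    private
      g : ℕ → Carrier
      g = gaussian p (n ℕ.+ n)

      p^[i+j]-0 : ∀ i j → n ≡ i ℕ.+ j → p ^ i * p ^ j ≈ 0#
      p^[i+j]-0 i j e = trans (sym (^-homo-* p i j)) (trans (^-congʳ p (≡.sym e)) pⁿ≈0)

      -- Gaussian coefficients away from the middle differ from `C`, but the monomial they multiply
      -- does not see the difference. Going from distance k to k + 1 multiplies the monomial by u =
      -- x p^k or y p^k and the coefficient by 1 - Q with Q = p^(n-k), up to the trivial factor 1 -
      -- P; and Q u contains p^n.
      step : ∀ {G G′ P Q u m m′} → (1# - P) * G′ ≈ (1# - Q) * G → P ≈ 0# → m′ ≈ u * m → Q * u ≈ 0# →
        G * m ≈ C * m → G′ * m′ ≈ C * m′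
      step {G} {G′} {P} {Q} {u} {m} {m′} ratio P≈0 m′≈um Qu≈0 Gm≈Cm = begin
        G′ * m′                ≈⟨ *-cong G′≈ m′≈um ⟩
        ((1# - Q) * G) * (u * m)
          ≈⟨ solve 4 (λ Q G u m → ((:1 :- Q) :* G) :* (u :* m) := u :* (G :* m) :- (Q :* u) :* (G :* m)) refl Q G u m ⟩
        u * (G * m) - (Q * u) * (G * m)
          ≈⟨ +-cong (*-congˡ Gm≈Cm) (trans (-‿cong (trans (*-congʳ Qu≈0) (zeroˡ _))) -0#≈0#) ⟩
        u * (C * m) + 0#       ≈⟨ +-identityʳ _ ⟩
        u * (C * m)            ≈⟨ solve 3 (λ u C m → u :* (C :* m) := C :* (u :* m)) refl u C m ⟩
        C * (u * m)            ≈⟨ *-congˡ m′≈um ⟨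
        C * m′                 ∎
        where
        G′≈ : G′ ≈ (1# - Q) * G
        G′≈ = begin
          G′              ≈⟨ *-identityˡ G′ ⟨
          1# * G′         ≈⟨ *-congʳ (trans (+-congˡ (trans (-‿cong P≈0) -0#≈0#)) (+-identityʳ 1#)) ⟨
          (1# - P) * G′   ≈⟨ ratio ⟩
          (1# - Q) * G    ∎

    module _ {x y} (xy≈p : x * y ≈ p) where
      private
        θ : ℤ → Carrier
        θ = θ-term x y

        up : ∀ k j → n ≡ k ℕ.+ j → g (n ℕ.+ k) * θ (+ k) ≈ C * θ (+ k)
        up zero    j e = *-congʳ (reflexive (≡.cong g (ℕₚ.+-identityʳ n)))
        up (suc k) j e = trans (*-congʳ (reflexive (≡.cong g (ℕₚ.+-suc n k))))
          (step ratio (^-≤-0 pⁿ≈0 (ℕₚ.m≤n⇒m≤1+n (ℕₚ.m≤m+n n k)))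
            (trans (*-congʳ (^-congʳ x (≡.cong suc (≡.cong (k ℕ.+_) (triangle≡n+T′ k)))))
              (trans (*-congˡ (^-congʳ y (triangle≡n+T′ k))) shift))
            (trans (solve 3 (λ q x r → q :* (x :* r) := x :* (r :* q)) refl (p ^ suc j) x (p ^ k))
              (trans (*-congˡ (p^[i+j]-0 k (suc j) (≡.trans e (≡.sym (ℕₚ.+-suc k j))))) (zeroʳ x)))
            (up k (suc j) (≡.trans e (≡.sym (ℕₚ.+-suc k j)))))
          where
          ratio : (1# - p ^ suc (n ℕ.+ k)) * g (suc (n ℕ.+ k)) ≈ (1# - p ^ suc j) * g (n ℕ.+ k)
          ratio = ≡.subst (λ N → (1# - p ^ suc (n ℕ.+ k)) * gaussian p N (suc (n ℕ.+ k)) ≈ (1# - p ^ suc j) * gaussian p N (n ℕ.+ k))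
            (≡.trans (ℕₚ.+-assoc n k (suc j)) (≡.cong (n ℕ.+_) (≡.trans (ℕₚ.+-suc k j) (≡.sym e))))
            (gaussian-ratio p (n ℕ.+ k) (suc j))
          shift : x ^ suc (k ℕ.+ (k ℕ.+ T′ (+ k))) * y ^ (k ℕ.+ T′ (+ k)) ≈ (x * p ^ k) * θ (+ k)
          shift = trans (*-assoc _ _ _) (trans (*-congˡ (trans
            (*-congʳ (^-congʳ x (≡.cong (k ℕ.+_) (≡.sym (triangle≡n+T′ k))))) (sym (p^-absorb xy≈p k _ _)))) (sym (*-assoc _ _ _)))

        down : ∀ k j → n ≡ k ℕ.+ j → g j * θ (0 ⊖ k) ≈ C * θ (0 ⊖ k)
        down zero    j ≡.refl = refl
        down (suc k) j e = step ratio (^-≤-0 pⁿ≈0 (ℕₚ.m≤m+n n (suc k)))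
          (trans (sym (*-identityˡ _)) (θ-term-step xy≈p 0 k))
          (trans (solve 3 (λ q y r → q :* (y :* r) := y :* (r :* q)) refl (p ^ suc j) y (p ^ k))
            (trans (*-congˡ (p^[i+j]-0 k (suc j) (≡.trans e (≡.sym (ℕₚ.+-suc k j))))) (zeroʳ y)))
          (down k (suc j) (≡.trans e (≡.sym (ℕₚ.+-suc k j))))
          where
          ratio : (1# - p ^ (n ℕ.+ suc k)) * g j ≈ (1# - p ^ suc j) * g (suc j)
          ratio = ≡.subst (λ N → (1# - p ^ (n ℕ.+ suc k)) * gaussian p N j ≈ (1# - p ^ suc j) * gaussian p N (suc j))
            (≡.trans (ℕₚ.+-comm j _) (≡.trans (ℕₚ.+-assoc n (suc k) j) (≡.cong (n ℕ.+_) (≡.sym e))))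
            (sym (gaussian-ratio p j (n ℕ.+ suc k)))

        constant : ∀ i → i ℕ.< suc (n ℕ.+ n) → g i * θ (i ⊖ n) ≈ C * θ (i ⊖ n)
        constant i (s≤s i≤2n) with ℕₚ.≤-total n i
        ... | inj₁ n≤i = ≡.subst (λ i → g i * θ (i ⊖ n) ≈ C * θ (i ⊖ n)) (ℕₚ.m+[n∸m]≡n n≤i)
              (≡.subst (λ k → g (n ℕ.+ (i ℕ.∸ n)) * θ k ≈ C * θ k) (≡.sym (≡.trans (≡.cong (_⊖ n) (ℕₚ.+-comm n (i ℕ.∸ n))) (lemma (i ℕ.∸ n))))
                (up (i ℕ.∸ n) (n ℕ.∸ (i ℕ.∸ n)) (≡.sym (ℕₚ.m+[n∸m]≡n (ℕₚ.m≤n+o⇒m∸n≤o i n i≤2n)))))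
          where
          lemma : ∀ k → (k ℕ.+ n) ⊖ n ≡ + k
          lemma k = ≡.trans (ℤₚ.⊖-≥ (ℕₚ.m≤n+m n k)) (≡.cong +_ (ℕₚ.m+n∸n≡m k n))
        ... | inj₂ i≤n = ≡.subst (λ k → g i * θ k ≈ C * θ k) (≡.trans (≡.sym (ℤₚ.+-cancelˡ-⊖ i 0 (n ℕ.∸ i)))
              (≡.cong₂ _⊖_ (ℕₚ.+-identityʳ i) (ℕₚ.m+[n∸m]≡n i≤n)))
              (down (n ℕ.∸ i) i (≡.sym (ℕₚ.m∸n+n≡m i≤n)))

      triple-product : ∏ n (λ i → 1# + x * p ^ i) * ∏ n (λ i → 1# + y * p ^ i) ≈ C * θ-sum x y
      triple-product = begin
        ∏ n (λ i → 1# + x * p ^ i) * ∏ n (λ i → 1# + y * p ^ i)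
          ≈⟨ finite-triple-product xy≈p n n ⟩
        ∑ (suc (n ℕ.+ n)) (λ i → g i * θ (i ⊖ n))
          ≈⟨ ∑-cong< (suc (n ℕ.+ n)) constant ⟩
        ∑ (suc (n ℕ.+ n)) (λ i → C * θ (i ⊖ n))
          ≈⟨ ∑-*ˡ (suc (n ℕ.+ n)) C (λ i → θ (i ⊖ n)) ⟨
        C * ∑ (suc (n ℕ.+ n)) (λ i → θ (i ⊖ n))
          ≈⟨ *-congˡ (begin
               ∑ (suc (n ℕ.+ n)) (λ i → θ (i ⊖ n))
                 ≈⟨ ∑-cong (suc (n ℕ.+ n)) (λ i → reflexive (≡.cong θ (window i))) ⟩
               ∑ (suc (n ℕ.+ n)) (λ i → θ (ℤ.- + suc n ℤ.+ + suc i))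
                 ≈⟨ +-identityˡ _ ⟨
               0# + ∑ (suc (n ℕ.+ n)) (λ i → θ (ℤ.- + suc n ℤ.+ + suc i))
                 -- The window of `θ-sum` has one index more, namely -(n + 1), where the term is
                 -- zero.
                 ≈⟨ +-congʳ (θ-supported xy≈p (ℤ.- + suc n ℤ.+ + 0) ℕₚ.≤-refl) ⟨
               ∑ (suc (suc (n ℕ.+ n))) (λ i → θ (ℤ.- + suc n ℤ.+ + i))
                 ≈⟨ reflexive (≡.cong (λ N → ∑ N (λ i → θ (ℤ.- + suc n ℤ.+ + i))) (≡.cong suc (≡.sym (ℕₚ.+-suc n n)))) ⟩
               θ-sum x y ∎) ⟩
        C * θ-sum x y ∎
        where
        window : ∀ i → i ⊖ n ≡ ℤ.- + suc n ℤ.+ + suc i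
        window i = ≡.trans (≡.sym (ℤₚ.[1+m]⊖[1+n]≡m⊖n i n)) (≡.sym (ℤₚ.-m+n≡n⊖m (suc n) (suc i)))

    θ-product : Carrier → Carrier → Carrier
    θ-product x y = ∏ n (λ i → 1# - x * p ^ i) * ∏ n (λ i → 1# - y * p ^ i)

    θ-product-cong : ∀ {x x′ y y′} → x ≈ x′ → y ≈ y′ → θ-product x y ≈ θ-product x′ y′
    θ-product-cong x≈x′ y≈y′ = *-cong
      (∏-cong n λ i → +-congˡ (-‿cong (*-congʳ x≈x′)))
      (∏-cong n λ i → +-congˡ (-‿cong (*-congʳ y≈y′)))

    θ-product≈C*θ-sum : ∀ {x y} x₋ y₋ → x₋ ≈ - x → y₋ ≈ - y → x * y ≈ p → θ-product x y ≈ C * θ-sum x₋ y₋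
    θ-product≈C*θ-sum {x} {y} x₋ y₋ x₋≈ y₋≈ xy≈p = trans
      (*-cong (∏-cong n λ i → +-congˡ (negate x₋≈)) (∏-cong n λ i → +-congˡ (negate y₋≈)))
      (triple-product (trans (*-cong x₋≈ y₋≈) (trans (solve 2 (λ x y → :- x :* :- y := x :* y) refl x y) xy≈p)))
      where
      negate : ∀ {x x₋ r} → x₋ ≈ - x → - (x * r) ≈ x₋ * r
      negate x₋≈ = trans (-‿distribˡ-* _ _) (*-congʳ (sym x₋≈))

    -- With b = x/y, Y = y² and W = p/x² this is the product of θ(xy) and θ(x/y).
    θ-pair : Carrier → Carrier → Carrier → Carrier
    θ-pair b Y W = θ-product (b * Y) (b * W) * θ-product (b * Y * W) b

    -- All four arguments are linear in `b`. Replacing `b` by `- b` therefore turns the factors 1 -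
    -- ... into the factors 1 + ... of the triple product, while b² and hence the arguments of `e`
    -- and `o` stay the same; only the coefficient `b` of the odd part changes sign.
    θ-pair-formula : ∀ b Y W → b * b * Y * W ≈ p →
      θ-pair b Y W ≈ (C * C) * (o (b * b * Y) W * e Y (b * b * W) - b * (e (b * b * Y) W * o Y (b * b * W)))
    θ-pair-formula b Y W bbYW≈p = begin
      θ-pair b Y W
        ≈⟨ *-cong
             (θ-product≈C*θ-sum (b₋ * Y) (b₋ * W) (sym (-‿distribˡ-* b Y)) (sym (-‿distribˡ-* b W))
               (trans (solve 3 (λ b Y W → (b :* Y) :* (b :* W) := b :* b :* Y :* W) refl b Y W) bbYW≈p))
             (θ-product≈C*θ-sum (b₋ * Y * W) b₋
               (solve 3 (λ b Y W → :- b :* Y :* W := :- (b :* Y :* W)) refl b Y W) refl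
               (trans (solve 3 (λ b Y W → (b :* Y :* W) :* b := b :* b :* Y :* W) refl b Y W) bbYW≈p)) ⟩
      (C * θ-sum (b₋ * Y) (b₋ * W)) * (C * θ-sum (b₋ * Y * W) b₋)
        ≈⟨ solve 3 (λ C s t → (C :* s) :* (C :* t) := (C :* C) :* (s :* t)) refl C _ _ ⟩
      (C * C) * (θ-sum (b₋ * Y) (b₋ * W) * θ-sum (b₋ * Y * W) b₋)
        ≈⟨ *-congˡ (θ-sum-product b₋ Y W (trans (*-congʳ (*-congʳ b₋²≈b²)) bbYW≈p)) ⟩
      (C * C) * (o (b₋ * b₋ * Y) W * e Y (b₋ * b₋ * W) + b₋ * (e (b₋ * b₋ * Y) W * o Y (b₋ * b₋ * W)))
        ≈⟨ *-congˡ (+-cong (*-cong (o-cong (*-congʳ b₋²≈b²) refl) (e-cong refl (*-congʳ b₋²≈b²)))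
             (trans (sym (-‿distribˡ-* b _)) (-‿cong (*-congˡ (*-cong (e-cong (*-congʳ b₋²≈b²) refl) (o-cong refl (*-congʳ b₋²≈b²))))))) ⟩
      (C * C) * (o (b * b * Y) W * e Y (b * b * W) - b * (e (b * b * Y) W * o Y (b * b * W))) ∎
      where
      b₋ = - b
      b₋²≈b² : b₋ * b₋ ≈ b * b
      b₋²≈b² = solve 1 (λ b → :- b :* :- b := b :* b) refl b

    -- The points are x, y, u, v with b₁ = x/y, b₂ = y/u, b₃ = u/v, V = v² and W = p/x². By
    -- θ-pair-formula every θ-pair is a 2 × 2 determinant, so that this is a Plücker relation.
    weierstrass : ∀ b₁ b₂ b₃ V W → let U = b₃ * b₃ * V ; Y = b₂ * b₂ * U in
      b₁ * b₁ * Y * W ≈ p →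
      b₂ * (θ-pair b₁ Y W * θ-pair b₃ V (b₂ * b₂ * (b₁ * b₁ * W)))
          + θ-pair (b₁ * b₂ * b₃) V W * θ-pair b₂ U (b₁ * b₁ * W)
        ≈ θ-pair (b₁ * b₂) U W * θ-pair (b₂ * b₃) V (b₁ * b₁ * W)
    weierstrass b₁ b₂ b₃ V W XW≈p = begin
      b₂ * (θ-pair b₁ Y W * θ-pair b₃ V WU) + θ-pair (b₁ * b₂ * b₃) V W * θ-pair b₂ U WY
        ≈⟨ +-cong (*-congˡ (*-cong xy uv)) (*-cong xv yu) ⟩
      b₂ * ((D * (oX * eY - b₁ * (eX * oY))) * (D * (oU * eV - b₃ * (eU * oV))))
          + (D * (oX * eV - b₁ * b₂ * b₃ * (eX * oV))) * (D * (oY * eU - b₂ * (eY * oU)))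
        -- The columns of the matrix are (o, x e), one for each point. The minor of x and y is y
        -- times the bracket above, and similarly for the others; dividing the Plücker relation by u
        -- v leaves the coefficient y/u = `b₂` on the first term and 1 on the other two.
        ≈⟨ solve 12 (λ b₁ b₂ b₃ D oX eX oY eY oU eU oV eV →
             b₂ :* ((D :* (oX :* eY :- b₁ :* (eX :* oY))) :* (D :* (oU :* eV :- b₃ :* (eU :* oV))))
               :+ (D :* (oX :* eV :- b₁ :* b₂ :* b₃ :* (eX :* oV))) :* (D :* (oY :* eU :- b₂ :* (eY :* oU)))
             := (D :* (oX :* eU :- b₁ :* b₂ :* (eX :* oU))) :* (D :* (oY :* eV :- b₂ :* b₃ :* (eY :* oV))))
             refl b₁ b₂ b₃ D oX eX oY eY oU eU oV eV ⟩
      (D * (oX * eU - b₁ * b₂ * (eX * oU))) * (D * (oY * eV - b₂ * b₃ * (eY * oV)))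
        ≈⟨ *-cong xu yv ⟨
      θ-pair (b₁ * b₂) U W * θ-pair (b₂ * b₃) V WY ∎
      where
      U Y X WY WU WV D oX eX oY eY oU eU oV eV : Carrier
      U = b₃ * b₃ * V
      Y = b₂ * b₂ * U
      X = b₁ * b₁ * Y
      WY = b₁ * b₁ * W
      WU = b₂ * b₂ * WY
      WV = b₃ * b₃ * WU
      D = C * C
      oX = o X W
      eX = e X W
      oY = o Y WY
      eY = e Y WY
      oU = o U WU
      eU = e U WU
      oV = o V WV
      eV = e V WV
      sq-* : ∀ a b Z → (a * b) * (a * b) * Z ≈ a * a * (b * b * Z)
      sq-* = solve 3 (λ a b Z → (a :* b) :* (a :* b) :* Z := a :* a :* (b :* b :* Z)) refl
      pair : ∀ b Z W {Z′ W′} → b * b * Z ≈ Z′ → b * b * W ≈ W′ → b * b * Z * W ≈ p →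
        θ-pair b Z W ≈ D * (o Z′ W * e Z W′ - b * (e Z′ W * o Z W′))
      pair b Z W Z′≈ W′≈ h = trans (θ-pair-formula b Z W h) (*-congˡ (+-cong
        (*-cong (o-cong Z′≈ refl) (e-cong refl W′≈))
        (-‿cong (*-congˡ (*-cong (e-cong Z′≈ refl) (o-cong refl W′≈))))))
      move : ∀ b Z W → b * b * Z * W ≈ Z * (b * b * W)
      move = solve 3 (λ b Z W → b :* b :* Z :* W := Z :* (b :* b :* W)) refl
      YWY≈p : Y * WY ≈ p
      YWY≈p = trans (sym (move b₁ Y W)) XW≈p
      UWU≈p : U * WU ≈ p
      UWU≈p = trans (sym (move b₂ U WY)) YWY≈p
      xy = pair b₁ Y W refl refl XW≈p
      yu = pair b₂ U WY refl refl YWY≈p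
      uv = pair b₃ V WU refl refl UWU≈p
      xu = pair (b₁ * b₂) U W (sq-* b₁ b₂ U) (trans (sq-* b₁ b₂ W) (swap b₁ b₂ W)) (trans (*-congʳ (sq-* b₁ b₂ U)) XW≈p)
        where
        swap : ∀ a b Z → a * a * (b * b * Z) ≈ b * b * (a * a * Z)
        swap = solve 3 (λ a b Z → a :* a :* (b :* b :* Z) := b :* b :* (a :* a :* Z)) refl
      yv = pair (b₂ * b₃) V WY (sq-* b₂ b₃ V)
        (solve 3 (λ a b Z → (a :* b) :* (a :* b) :* Z := b :* b :* (a :* a :* Z)) refl b₂ b₃ WY) (trans (*-congʳ (sq-* b₂ b₃ V)) YWY≈p)
      xv = pair (b₁ * b₂ * b₃) V W cube (solve 4 (λ a b c Z → (a :* b :* c) :* (a :* b :* c) :* Z := c :* c :* (b :* b :* (a :* a :* Z))) refl b₁ b₂ b₃ W)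
        (trans (*-congʳ cube) XW≈p)
        where
        cube : (b₁ * b₂ * b₃) * (b₁ * b₂ * b₃) * V ≈ X
        cube = solve 4 (λ a b c Z → (a :* b :* c) :* (a :* b :* c) :* Z := a :* a :* (b :* b :* (c :* c :* Z))) refl b₁ b₂ b₃ V

-- Products of theta functions as products over residue classes modulo 48

insert : ℕ → List ℕ → List ℕ
insert x []       = x ∷ []
insert x (y ∷ ys) = if x ℕ.≤ᵇ y then x ∷ y ∷ ys else y ∷ insert x ys

± : List ℕ → List ℕ
± rs = rs ++ map (48 ℕ.∸_) rs

sort : List ℕ → List ℕ
sort []       = []
sort (x ∷ xs) = insert x (sort xs)

S-i T-i : List ℕ
S-i = 1 ∷ 4 ∷ 7 ∷ 9 ∷ 10 ∷ 11 ∷ 12 ∷ 13 ∷ 14 ∷ 15 ∷ 17 ∷ 23 ∷ []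
T-i = 1 ∷ 3 ∷ 7 ∷ 8 ∷ 10 ∷ 11 ∷ 12 ∷ 13 ∷ 17 ∷ 21 ∷ 22 ∷ 23 ∷ []

S-ii T-ii : List ℕ
S-ii = 2 ∷ 5 ∷ 7 ∷ 8 ∷ 9 ∷ 11 ∷ 12 ∷ 13 ∷ 14 ∷ 15 ∷ 17 ∷ 19 ∷ []
T-ii = 2 ∷ 3 ∷ 5 ∷ 7 ∷ 11 ∷ 12 ∷ 13 ∷ 17 ∷ 19 ∷ 20 ∷ 21 ∷ 22 ∷ []

S-iii T-iii : List ℕ
S-iii = 1 ∷ 3 ∷ 5 ∷ 7 ∷ 8 ∷ 10 ∷ 12 ∷ 17 ∷ 19 ∷ 21 ∷ 22 ∷ 23 ∷ []
T-iii = 1 ∷ 2 ∷ 5 ∷ 7 ∷ 9 ∷ 12 ∷ 15 ∷ 17 ∷ 19 ∷ 20 ∷ 22 ∷ 23 ∷ []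

S-iv T-iv : List ℕ
S-iv = 1 ∷ 2 ∷ 5 ∷ 8 ∷ 9 ∷ 11 ∷ 12 ∷ 13 ∷ 14 ∷ 15 ∷ 19 ∷ 23 ∷ []
T-iv = 1 ∷ 3 ∷ 4 ∷ 5 ∷ 10 ∷ 11 ∷ 12 ∷ 13 ∷ 14 ∷ 19 ∷ 21 ∷ 23 ∷ []

VanishingPower : ∀ {c ℓ} (R : CommutativeRing c ℓ) → CommutativeRing.Carrier R → ℕ → Set ℓ
VanishingPower R q N = q ^ N ≈ 0#
  where open RingTheory R

module Level48 {c ℓ} (R : CommutativeRing c ℓ) (q : CommutativeRing.Carrier R) (K : ℕ)
  (nilpotent : VanishingPower R q (48 ℕ.* K)) where

  open ThetaRelations R public

  q^-0 : ∀ {m} → 48 ℕ.* K ℕ.≤ m → q ^ m ≈ 0#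
  q^-0 = ^-≤-0 nilpotent

  Unit : Carrier → Set _
  Unit u = ∃ λ v → u * v ≈ 1#

  Unit-* : ∀ {u w} → Unit u → Unit w → Unit (u * w)
  Unit-* {u} {w} (u′ , uu′≈1) (w′ , ww′≈1) = u′ * w′ ,
    trans (solve 4 (λ u w u′ w′ → (u :* w) :* (u′ :* w′) := (u :* u′) :* (w :* w′)) refl u w u′ w′)
      (trans (*-cong uu′≈1 ww′≈1) (*-identityˡ 1#))

  Unit-cancel : ∀ {u a b} → Unit u → u * a ≈ u * b → a ≈ b
  Unit-cancel {u} {a} {b} (v , uv≈1) ua≈ub = begin
    a             ≈⟨ strip a ⟨
    v * (u * a)   ≈⟨ *-congˡ ua≈ub ⟩
    v * (u * b)   ≈⟨ strip b ⟩
    b             ∎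
    where
    strip : ∀ a → v * (u * a) ≈ a
    strip a = trans (solve 3 (λ u v a → v :* (u :* a) := (u :* v) :* a) refl u v a)
      (trans (*-congʳ uv≈1) (*-identityˡ a))

  geometric : ∀ N t → (1# - t) * ∑ N (λ i → t ^ i) ≈ 1# - t ^ N
  geometric zero    t = trans (zeroʳ _) (sym (-‿inverseʳ 1#))
  geometric (suc N) t = begin
    (1# - t) * (1# + ∑ N (λ i → t * t ^ i))
      ≈⟨ *-congˡ (+-congˡ (∑-*ˡ N t (λ i → t ^ i))) ⟨
    (1# - t) * (1# + t * ∑ N (λ i → t ^ i))
      ≈⟨ solve 2 (λ t s → (:1 :- t) :* (:1 :+ t :* s) := (:1 :- t) :+ t :* ((:1 :- t) :* s)) refl t (∑ N (λ i → t ^ i)) ⟩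
    (1# - t) + t * ((1# - t) * ∑ N (λ i → t ^ i))
      ≈⟨ +-congˡ (*-congˡ (geometric N t)) ⟩
    (1# - t) + t * (1# - t ^ N)
      ≈⟨ solve 2 (λ t s → (:1 :- t) :+ t :* (:1 :- s) := :1 :- t :* s) refl t (t ^ N) ⟩
    1# - t * t ^ N ∎

  Unit-1-q^ : ∀ m → Unit (1# - q ^ suc m)
  Unit-1-q^ m = _ , trans (geometric (48 ℕ.* K) (q ^ suc m)) (trans (+-congˡ (trans (-‿cong tᴺ≈0) -0#≈0#)) (+-identityʳ 1#))
    where
    tᴺ≈0 : (q ^ suc m) ^ (48 ℕ.* K) ≈ 0#
    tᴺ≈0 = trans (^-assocʳ q (suc m) (48 ℕ.* K)) (q^-0 (ℕₚ.m≤m+n _ _))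

  -- F r is (q^r ; q^48)_∞, since q^(48 K) = 0.
  F : ℕ → Carrier
  F r = ∏ K λ i → 1# - q ^ (r ℕ.+ 48 ℕ.* i)

  P : List ℕ → Carrier
  P []       = 1#
  P (r ∷ rs) = F r * P rs

  P-++ : ∀ rs ss → P (rs ++ ss) ≈ P rs * P ss
  P-++ []       ss = sym (*-identityˡ _)
  P-++ (r ∷ rs) ss = trans (*-congˡ (P-++ rs ss)) (sym (*-assoc _ _ _))

  P-insert : ∀ r rs → P (insert r rs) ≈ F r * P rs
  P-insert r []       = refl
  P-insert r (s ∷ rs) with r ℕ.≤ᵇ s
  ... | true  = refl
  ... | false = trans (*-congˡ (P-insert r rs)) (solve 3 (λ r s rs → s :* (r :* rs) := r :* (s :* rs)) refl (F r) (F s) (P rs))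

  P-sort : ∀ rs → P (sort rs) ≈ P rs
  P-sort []       = refl
  P-sort (r ∷ rs) = trans (P-insert r (sort rs)) (*-congˡ (P-sort rs))

  -- Sorted lists serve as normal forms of multisets of residues, so that every rearrangement of
  -- concrete products below is checked by evaluation.
  P-permute : ∀ rs ss → sort rs ≡ sort ss → P rs ≈ P ss
  P-permute rs ss e = trans (sym (P-sort rs)) (trans (reflexive (≡.cong P e)) (P-sort ss))

  P-product : ∀ rs ss ts us → sort (rs ++ ss) ≡ sort (ts ++ us) → P rs * P ss ≈ P ts * P us
  P-product rs ss ts us e = trans (sym (P-++ rs ss)) (trans (P-permute (rs ++ ss) (ts ++ us) e) (P-++ ts us))

  -- Since q is nilpotent, a finite geometric series inverts 1 - q^m for positive m. The residue 0
  -- is excluded because `F 0` would contain the factor 1 - q⁰.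
  Unit-P : ∀ rs → all (0 ℕ.<ᵇ_) rs ≡ true → Unit (P rs)
  Unit-P []           _ = 1# , *-identityˡ 1#
  Unit-P (suc r ∷ rs) h = Unit-* (Unit-∏ K λ i → Unit-1-q^ (r ℕ.+ 48 ℕ.* i)) (Unit-P rs h)
    where
    Unit-∏ : ∀ N {f} → (∀ i → Unit (f i)) → Unit (∏ N f)
    Unit-∏ zero    u = 1# , *-identityˡ 1#
    Unit-∏ (suc N) u = Unit-* (u 0) (Unit-∏ N (u ∘ suc))

  signed : Bool → Carrier → Carrier
  signed false x = x
  signed true  x = - x

  ±q : Bool → ℕ → Carrier
  ±q s a = signed s (q ^ a)

  ±q-* : ∀ s t a b → ±q s a * ±q t b ≈ ±q (s xor t) (a ℕ.+ b)
  ±q-* false false a b = sym (^-homo-* q a b)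
  ±q-* false true  a b = trans (sym (-‿distribʳ-* _ _)) (-‿cong (sym (^-homo-* q a b)))
  ±q-* true  false a b = trans (sym (-‿distribˡ-* _ _)) (-‿cong (sym (^-homo-* q a b)))
  ±q-* true  true  a b = trans (solve 2 (λ a b → :- a :* :- b := a :* b) refl _ _) (sym (^-homo-* q a b))

  -- With p = q²⁴ this makes p^n = q^(48 K) = 0, and being even it lets a product over n powers of
  -- q²⁴ split into two products over classes modulo 48.
  n : ℕ
  n = K ℕ.+ K

  q²⁴ : Carrier
  q²⁴ = q ^ 24

  q²⁴ⁿ≈0 : q²⁴ ^ n ≈ 0#
  q²⁴ⁿ≈0 = trans (^-assocʳ q 24 n) (q^-0 (ℕₚ.≤-reflexive (lemma K)))
    where
    lemma : ∀ K → 48 ℕ.* K ≡ 24 ℕ.* (K ℕ.+ K)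
    lemma = ℕ-Solver.solve-∀

  open Nilpotent n q²⁴ⁿ≈0 public

  private
    q^a*q²⁴^i : ∀ a i → q ^ a * q²⁴ ^ i ≈ q ^ (a ℕ.+ 24 ℕ.* i)
    q^a*q²⁴^i a i = trans (*-congˡ (^-assocʳ q 24 i)) (sym (^-homo-* q a (24 ℕ.* i)))

    half : ∀ a → ∏ n (λ i → 1# - q ^ a * q²⁴ ^ i) ≈ F a * F (a ℕ.+ 24)
    half a = begin
      ∏ n (λ i → 1# - q ^ a * q²⁴ ^ i)
        ≈⟨ ∏-cong n (λ i → +-congˡ (-‿cong (q^a*q²⁴^i a i))) ⟩
      ∏ n (λ i → 1# - q ^ (a ℕ.+ 24 ℕ.* i))
        ≈⟨ ∏-double K (λ i → 1# - q ^ (a ℕ.+ 24 ℕ.* i)) ⟩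
      ∏ K (λ i → (1# - q ^ (a ℕ.+ 24 ℕ.* (i ℕ.+ i))) * (1# - q ^ (a ℕ.+ 24 ℕ.* suc (i ℕ.+ i))))
        ≈⟨ ∏-cong K (λ i → reflexive (≡.cong₂ (λ u v → (1# - q ^ u) * (1# - q ^ v)) (even a i) (odd a i))) ⟩
      ∏ K (λ i → (1# - q ^ (a ℕ.+ 48 ℕ.* i)) * (1# - q ^ ((a ℕ.+ 24) ℕ.+ 48 ℕ.* i)))
        ≈⟨ ∏-* K (λ i → 1# - q ^ (a ℕ.+ 48 ℕ.* i)) (λ i → 1# - q ^ ((a ℕ.+ 24) ℕ.+ 48 ℕ.* i)) ⟩
      F a * F (a ℕ.+ 24) ∎
      where
      even : ∀ a i → a ℕ.+ 24 ℕ.* (i ℕ.+ i) ≡ a ℕ.+ 48 ℕ.* i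
      even = ℕ-Solver.solve-∀
      odd : ∀ a i → a ℕ.+ 24 ℕ.* suc (i ℕ.+ i) ≡ (a ℕ.+ 24) ℕ.+ 48 ℕ.* i
      odd = ℕ-Solver.solve-∀

    -- By (1 + t)(1 - t) = 1 - t² the step 24 of the exponents becomes 48. The product for -q^a is
    -- thus a quotient, stated here with its denominator on the left.
    half₋ : ∀ a → ∏ n (λ i → 1# - (- q ^ a) * q²⁴ ^ i) * (F a * F (a ℕ.+ 24)) ≈ F (a ℕ.+ a)
    half₋ a = begin
      ∏ n (λ i → 1# - (- q ^ a) * q²⁴ ^ i) * (F a * F (a ℕ.+ 24))
        ≈⟨ *-congˡ (half a) ⟨
      ∏ n (λ i → 1# - (- q ^ a) * q²⁴ ^ i) * ∏ n (λ i → 1# - q ^ a * q²⁴ ^ i)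
        ≈⟨ ∏-* n (λ i → 1# - (- q ^ a) * q²⁴ ^ i) (λ i → 1# - q ^ a * q²⁴ ^ i) ⟨
      ∏ n (λ i → (1# - (- q ^ a) * q²⁴ ^ i) * (1# - q ^ a * q²⁴ ^ i))
        ≈⟨ ∏-cong n (λ i → trans
             (solve 2 (λ a b → (:1 :- (:- a) :* b) :* (:1 :- a :* b) := :1 :- (a :* b) :* (a :* b)) refl (q ^ a) (q²⁴ ^ i))
             (+-congˡ (-‿cong (trans (*-cong (q^a*q²⁴^i a i) (q^a*q²⁴^i a i))
               (trans (sym (^-homo-* q (a ℕ.+ 24 ℕ.* i) (a ℕ.+ 24 ℕ.* i))) (^-congʳ q (lemma₁ a i))))))) ⟩
      ∏ n (λ i → 1# - q ^ ((a ℕ.+ a) ℕ.+ 48 ℕ.* i))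
        ≈⟨ ∏-split K K (λ i → 1# - q ^ ((a ℕ.+ a) ℕ.+ 48 ℕ.* i)) ⟩
      F (a ℕ.+ a) * ∏ K (λ i → 1# - q ^ ((a ℕ.+ a) ℕ.+ 48 ℕ.* (K ℕ.+ i)))
        -- The second half of the 2K factors has exponents of at least 48 K, so each of them is 1.
        ≈⟨ *-congˡ (∏-1 K λ i _ → trans (+-congˡ (trans (-‿cong (q^-0 (ℕₚ.≤-trans (ℕₚ.*-monoʳ-≤ 48 (ℕₚ.m≤m+n K i)) (ℕₚ.m≤n+m (48 ℕ.* (K ℕ.+ i)) (a ℕ.+ a))))) -0#≈0#)) (+-identityʳ 1#)) ⟩
      F (a ℕ.+ a) * 1#  ≈⟨ *-identityʳ _ ⟩
      F (a ℕ.+ a) ∎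
      where
      lemma₁ : ∀ a i → (a ℕ.+ 24 ℕ.* i) ℕ.+ (a ℕ.+ 24 ℕ.* i) ≡ (a ℕ.+ a) ℕ.+ 48 ℕ.* i
      lemma₁ = ℕ-Solver.solve-∀

  record Quotient (x : Carrier) (num den : List ℕ) : Set ℓ where
    constructor quotient
    field equation : x * P den ≈ P num

  open Quotient

  Quotient-* : ∀ {x y num num′ den den′} → Quotient x num den → Quotient y num′ den′ →
    Quotient (x * y) (num ++ num′) (den ++ den′)
  Quotient-* {x} {y} {num} {num′} {den} {den′} (quotient h) (quotient h′) = quotient (begin
    (x * y) * P (den ++ den′)    ≈⟨ *-congˡ (P-++ den den′) ⟩
    (x * y) * (P den * P den′)   ≈⟨ solve 4 (λ x y d d′ → (x :* y) :* (d :* d′) := (x :* d) :* (y :* d′)) refl x y _ _ ⟩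
    (x * P den) * (y * P den′)   ≈⟨ *-cong h h′ ⟩
    P num * P num′               ≈⟨ P-++ num num′ ⟨
    P (num ++ num′)              ∎)

  Quotient-≈ : ∀ {x y num den} → x ≈ y → Quotient y num den → Quotient x num den
  Quotient-≈ x≈y (quotient h) = quotient (trans (*-congʳ x≈y) h)

  θ-num θ-den : Bool → ℕ → ℕ → List ℕ
  θ-num false a c = a ∷ a ℕ.+ 24 ∷ c ∷ c ℕ.+ 24 ∷ []
  θ-num true  a c = a ℕ.+ a ∷ c ℕ.+ c ∷ []
  θ-den false a c = []
  θ-den true  a c = a ∷ a ℕ.+ 24 ∷ c ∷ c ℕ.+ 24 ∷ []

  θ-quotient : ∀ s a c → Quotient (θ-product (±q s a) (±q s c)) (θ-num s a c) (θ-den s a c)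
  θ-quotient false a c = quotient (trans (*-identityʳ _) (trans (*-cong (half a) (half c))
    (solve 4 (λ a b c d → (a :* b) :* (c :* d) := a :* (b :* (c :* (d :* :1)))) refl _ _ _ _)))
  θ-quotient true  a c = quotient (trans
    (solve 6 (λ x y a b c d → (x :* y) :* (a :* (b :* (c :* (d :* :1)))) := (x :* (a :* b)) :* (y :* (c :* d))) refl _ _ _ _ _ _)
    (trans (*-cong (half₋ a) (half₋ c)) (*-congˡ (sym (*-identityʳ _)))))

  pair-num pair-den : Bool → ℕ → ℕ → ℕ → List ℕ
  pair-num s b Y W = θ-num s (b ℕ.+ Y) (b ℕ.+ W) ++ θ-num s (b ℕ.+ Y ℕ.+ W) b
  pair-den s b Y W = θ-den s (b ℕ.+ Y) (b ℕ.+ W) ++ θ-den s (b ℕ.+ Y ℕ.+ W) b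

  pair-quotient : ∀ s b Y W {b′ Y′ W′} → b′ ≈ ±q s b → Y′ ≈ q ^ Y → W′ ≈ q ^ W →
    Quotient (θ-pair b′ Y′ W′) (pair-num s b Y W) (pair-den s b Y W)
  pair-quotient s b Y W {b′} {Y′} {W′} b≈ Y≈ W≈ = Quotient-*
    (Quotient-≈ (θ-product-cong (shift b Y b≈ Y≈) (shift b W b≈ W≈)) (θ-quotient s (b ℕ.+ Y) (b ℕ.+ W)))
    (Quotient-≈ (θ-product-cong (shift (b ℕ.+ Y) W (shift b Y b≈ Y≈) W≈) b≈) (θ-quotient s (b ℕ.+ Y ℕ.+ W) b))
    where
    xor-false : ∀ s → s xor false ≡ s
    xor-false false = ≡.refl
    xor-false true  = ≡.refl
    shift : ∀ {x y} a c → x ≈ ±q s a → y ≈ q ^ c → x * y ≈ ±q s (a ℕ.+ c)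
    shift a c x≈ y≈ = trans (*-cong x≈ y≈) (trans (±q-* s false a c) (reflexive (≡.cong (λ t → ±q t (a ℕ.+ c)) (xor-false s))))

  square : ∀ s a {x X} c → x ≈ ±q s a → X ≈ q ^ c → x * x * X ≈ q ^ (a ℕ.+ a ℕ.+ c)
  square s a c x≈ X≈ = trans (*-cong (trans (*-cong x≈ x≈) (trans (±q-* s s a a) (reflexive (≡.cong (λ t → ±q t (a ℕ.+ a)) (xor-self s)))))
    X≈) (sym (^-homo-* q (a ℕ.+ a) c))
    where
    xor-self : ∀ s → s xor s ≡ false
    xor-self false = ≡.refl
    xor-self true  = ≡.refl

  -- The three-term relation at points ±q^α, in terms of residues modulo 48

  module ThreeTerm (s₁ s₂ s₃ : Bool) (b₁ b₂ b₃ V W : ℕ) where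
    private
      U Y X WY WU : ℕ
      U = b₃ ℕ.+ b₃ ℕ.+ V
      Y = b₂ ℕ.+ b₂ ℕ.+ U
      X = b₁ ℕ.+ b₁ ℕ.+ Y
      WY = b₁ ℕ.+ b₁ ℕ.+ W
      WU = b₂ ℕ.+ b₂ ℕ.+ WY
      s₁₂ s₂₃ s₁₂₃ : Bool
      s₁₂ = s₁ xor s₂
      s₂₃ = s₂ xor s₃
      s₁₂₃ = s₁₂ xor s₃
    num₁ num₂ num₃ den₁ den₂ den₃ : List ℕ
    num₁ = pair-num s₁ b₁ Y W ++ pair-num s₃ b₃ V WU
    den₁ = pair-den s₁ b₁ Y W ++ pair-den s₃ b₃ V WU
    num₂ = pair-num s₁₂ (b₁ ℕ.+ b₂) U W ++ pair-num s₂₃ (b₂ ℕ.+ b₃) V WY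
    den₂ = pair-den s₁₂ (b₁ ℕ.+ b₂) U W ++ pair-den s₂₃ (b₂ ℕ.+ b₃) V WY
    num₃ = pair-num s₁₂₃ (b₁ ℕ.+ b₂ ℕ.+ b₃) V W ++ pair-num s₂ b₂ U WY
    den₃ = pair-den s₁₂₃ (b₁ ℕ.+ b₂ ℕ.+ b₃) V W ++ pair-den s₂ b₂ U WY

    three-term : X ℕ.+ W ≡ 24 →
      ±q s₂ b₂ * P (num₁ ++ den₂ ++ den₃) + P (num₃ ++ den₁ ++ den₂) ≈ P (num₂ ++ den₁ ++ den₃)
    three-term X+W≡24 = begin
      β₂ * P (num₁ ++ den₂ ++ den₃) + P (num₃ ++ den₁ ++ den₂)
        ≈⟨ +-cong (*-congˡ (cleared num₁ den₁ den₂ den₃ q₁)) (cleared num₃ den₃ den₁ den₂ q₃) ⟩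
      β₂ * (t₁ * P den₁ * (P den₂ * P den₃)) + t₃ * P den₃ * (P den₁ * P den₂)
        ≈⟨ solve 6 (λ β t₁ t₃ d₁ d₂ d₃ → β :* (t₁ :* d₁ :* (d₂ :* d₃)) :+ t₃ :* d₃ :* (d₁ :* d₂)
             := (β :* t₁ :+ t₃) :* d₂ :* (d₁ :* d₃)) refl β₂ t₁ t₃ (P den₁) (P den₂) (P den₃) ⟩
      (β₂ * t₁ + t₃) * P den₂ * (P den₁ * P den₃)
        ≈⟨ *-congʳ (*-congʳ (weierstrass β₁ β₂ β₃ (q ^ V) (q ^ W)
             (trans (*-congʳ X≈) (trans (sym (^-homo-* q X W)) (^-congʳ q X+W≡24))))) ⟩
      t₂ * P den₂ * (P den₁ * P den₃)
        ≈⟨ cleared num₂ den₂ den₁ den₃ q₂ ⟨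
      P (num₂ ++ den₁ ++ den₃) ∎
      where
      β₁ β₂ β₃ U′ Y′ WY′ WU′ : Carrier
      β₁ = ±q s₁ b₁
      β₂ = ±q s₂ b₂
      β₃ = ±q s₃ b₃
      U′ = β₃ * β₃ * q ^ V
      Y′ = β₂ * β₂ * U′
      WY′ = β₁ * β₁ * q ^ W
      WU′ = β₂ * β₂ * WY′
      U≈ = square s₃ b₃ V refl refl
      Y≈ = square s₂ b₂ U refl U≈
      X≈ = square s₁ b₁ Y refl Y≈
      WY≈ = square s₁ b₁ W refl refl
      WU≈ = square s₂ b₂ WY refl WY≈
      t₁ t₂ t₃ : Carrier
      t₁ = θ-pair β₁ Y′ (q ^ W) * θ-pair β₃ (q ^ V) WU′
      t₂ = θ-pair (β₁ * β₂) U′ (q ^ W) * θ-pair (β₂ * β₃) (q ^ V) WY′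
      t₃ = θ-pair (β₁ * β₂ * β₃) (q ^ V) (q ^ W) * θ-pair β₂ U′ WY′
      β₁₂≈ : β₁ * β₂ ≈ ±q s₁₂ (b₁ ℕ.+ b₂)
      β₁₂≈ = ±q-* s₁ s₂ b₁ b₂
      q₁ : Quotient t₁ num₁ den₁
      q₁ = Quotient-* (pair-quotient s₁ b₁ Y W refl Y≈ refl) (pair-quotient s₃ b₃ V WU refl refl WU≈)
      q₂ : Quotient t₂ num₂ den₂
      q₂ = Quotient-* (pair-quotient s₁₂ (b₁ ℕ.+ b₂) U W β₁₂≈ U≈ refl) (pair-quotient s₂₃ (b₂ ℕ.+ b₃) V WY (±q-* s₂ s₃ b₂ b₃) refl WY≈)
      q₃ : Quotient t₃ num₃ den₃
      q₃ = Quotient-* (pair-quotient s₁₂₃ (b₁ ℕ.+ b₂ ℕ.+ b₃) V W (trans (*-congʳ β₁₂≈) (±q-* s₁₂ s₃ (b₁ ℕ.+ b₂) b₃)) refl refl)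
        (pair-quotient s₂ b₂ U WY refl U≈ WY≈)
      cleared : ∀ num den ds es {t} → Quotient t num den → P (num ++ ds ++ es) ≈ t * P den * (P ds * P es)
      cleared num den ds es (quotient h) = trans (P-++ num (ds ++ es)) (*-cong (sym h) (P-++ ds es))

    -- Clearing the denominators of the three terms creates many common factors. They are collected
    -- in `ds`, whose product is a unit and can be cancelled.
    reduced : X ℕ.+ W ≡ 24 → ∀ ds as bs cs → all (0 ℕ.<ᵇ_) ds ≡ true →
      sort (num₁ ++ den₂ ++ den₃) ≡ sort (ds ++ as) →
      sort (num₂ ++ den₁ ++ den₃) ≡ sort (ds ++ bs) →
      sort (num₃ ++ den₁ ++ den₂) ≡ sort (ds ++ cs) →
      ±q s₂ b₂ * P as + P cs ≈ P bs
    reduced X+W≡24 ds as bs cs nz ea eb ec = Unit-cancel (Unit-P ds nz) (begin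
      P ds * (β₂ * P as + P cs)
        ≈⟨ solve 4 (λ d β a c → d :* (β :* a :+ c) := β :* (d :* a) :+ d :* c) refl (P ds) β₂ (P as) (P cs) ⟩
      β₂ * (P ds * P as) + P ds * P cs
        ≈⟨ +-cong (*-congˡ (factor (num₁ ++ den₂ ++ den₃) as ea)) (factor (num₃ ++ den₁ ++ den₂) cs ec) ⟨
      β₂ * P (num₁ ++ den₂ ++ den₃) + P (num₃ ++ den₁ ++ den₂)
        ≈⟨ three-term X+W≡24 ⟩
      P (num₂ ++ den₁ ++ den₃)
        ≈⟨ factor (num₂ ++ den₁ ++ den₃) bs eb ⟩
      P ds * P bs ∎)
      where
      β₂ = ±q s₂ b₂
      factor : ∀ rs xs → sort rs ≡ sort (ds ++ xs) → P rs ≈ P ds * P xs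
      factor rs xs e = trans (P-permute rs (ds ++ xs) e) (P-++ ds xs)

  -- The points (x, y, u, v) are (q¹¹, −q⁵, −q³, q), (q⁷, q⁴, −q³, q), (q¹¹, q⁴, q³, q²),
  -- (q⁸, q⁷, −q³, q) and (q⁷, q⁶, q⁴, q); common factors are cancelled.
  a1 b1 c1 : List ℕ
  a1 = ± (4 ∷ 10 ∷ 14 ∷ [])
  b1 = ± (2 ∷ 20 ∷ 22 ∷ [])
  c1 = ± (2 ∷ 2 ∷ 4 ∷ 6 ∷ 8 ∷ 10 ∷ 10 ∷ 12 ∷ 14 ∷ 14 ∷ 16 ∷ 18 ∷ 20 ∷ 22 ∷ 22 ∷ [])

  relation1 : ±q false 2 * P a1 + P c1 ≈ P b1
  relation1 = ThreeTerm.reduced true false true 6 2 2 2 2 ≡.refl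
    (± (4 ∷ 6 ∷ 8 ∷ 8 ∷ 12 ∷ 16 ∷ 16 ∷ 18 ∷ 20 ∷ []))
    a1 b1 c1 ≡.refl ≡.refl ≡.refl ≡.refl

  a2 b2 c2 : List ℕ
  a2 = ± (1 ∷ 3 ∷ 4 ∷ 7 ∷ 10 ∷ 11 ∷ 13 ∷ 14 ∷ 17 ∷ 21 ∷ 23 ∷ [])
  b2 = ± (1 ∷ 2 ∷ 3 ∷ 5 ∷ 7 ∷ 17 ∷ 19 ∷ 20 ∷ 21 ∷ 22 ∷ 23 ∷ [])
  c2 = ± (2 ∷ 2 ∷ 4 ∷ 6 ∷ 10 ∷ 14 ∷ 14 ∷ 16 ∷ 18 ∷ 20 ∷ 22 ∷ [])

  relation2 : ±q true 1 * P a2 + P c2 ≈ P b2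
  relation2 = ThreeTerm.reduced false true true 3 1 2 2 10 ≡.refl
    (± (4 ∷ 8 ∷ 20 ∷ []))
    a2 b2 c2 ≡.refl ≡.refl ≡.refl ≡.refl

  a3 b3 c3 : List ℕ
  a3 = ± (1 ∷ 5 ∷ 7 ∷ 9 ∷ 15 ∷ 17 ∷ 19 ∷ 23 ∷ [])
  b3 = ± (2 ∷ 6 ∷ 8 ∷ 10 ∷ 14 ∷ 16 ∷ 18 ∷ 22 ∷ [])
  c3 = ± (1 ∷ 7 ∷ 9 ∷ 11 ∷ 13 ∷ 15 ∷ 17 ∷ 23 ∷ [])

  relation3 : ±q false 1 * P a3 + P c3 ≈ P b3
  relation3 = ThreeTerm.reduced false false false 7 1 1 4 2 ≡.refl
    (± ([]))
    a3 b3 c3 ≡.refl ≡.refl ≡.refl ≡.refl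

  a4 b4 c4 : List ℕ
  a4 = ± (1 ∷ 4 ∷ 5 ∷ 9 ∷ 10 ∷ 11 ∷ 13 ∷ 14 ∷ 15 ∷ 19 ∷ 23 ∷ [])
  b4 = ± (2 ∷ 4 ∷ 6 ∷ 10 ∷ 10 ∷ 14 ∷ 16 ∷ 18 ∷ 20 ∷ 22 ∷ 22 ∷ [])
  c4 = ± (2 ∷ 5 ∷ 7 ∷ 9 ∷ 11 ∷ 13 ∷ 15 ∷ 17 ∷ 19 ∷ 20 ∷ 22 ∷ [])

  relation4 : ±q true 4 * P a4 + P c4 ≈ P b4
  relation4 = ThreeTerm.reduced false true true 1 4 2 2 8 ≡.refl
    (± (4 ∷ 8 ∷ 20 ∷ []))
    a4 b4 c4 ≡.refl ≡.refl ≡.refl ≡.refl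

  a5 b5 c5 : List ℕ
  a5 = ± (1 ∷ 3 ∷ 5 ∷ 11 ∷ 13 ∷ 19 ∷ 21 ∷ 23 ∷ [])
  b5 = ± (3 ∷ 5 ∷ 7 ∷ 11 ∷ 13 ∷ 17 ∷ 19 ∷ 21 ∷ [])
  c5 = ± (2 ∷ 6 ∷ 8 ∷ 10 ∷ 14 ∷ 16 ∷ 18 ∷ 22 ∷ [])

  relation5 : ±q false 2 * P a5 + P c5 ≈ P b5
  relation5 = ThreeTerm.reduced false false false 1 2 3 2 10 ≡.refl
    (± ([]))
    a5 b5 c5 ≡.refl ≡.refl ≡.refl ≡.refl

  -- The lists m are the cofactors of the relations, and h is the factor to be cancelled from their sum.
  combine : ∀ h {S T mT xT mS xS m x u v} → all (0 ℕ.<ᵇ_) h ≡ true →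
    sort (h ++ T) ≡ sort (mT ++ xT) → sort (h ++ S) ≡ sort (mS ++ xS) → sort (h ++ (S ++ T)) ≡ sort (m ++ x) →
    P mT * P xT ≈ u * (P mS * P xS) + v * (P m * P x) → P T ≈ u * P S + v * P (S ++ T)
  combine h {S} {T} {mT} {xT} {mS} {xS} {m} {x} {u} {v} nz eT eS e chain = Unit-cancel (Unit-P h nz) (begin
    P h * P T                               ≈⟨ P-product h T mT xT eT ⟩
    P mT * P xT                             ≈⟨ chain ⟩
    u * (P mS * P xS) + v * (P m * P x)     ≈⟨ +-cong (*-congˡ (P-product h S mS xS eS)) (*-congˡ (P-product h (S ++ T) m x e)) ⟨
    u * (P h * P S) + v * (P h * P (S ++ T))
      ≈⟨ solve 5 (λ u v h s t → u :* (h :* s) :+ v :* (h :* t) := h :* (u :* s :+ v :* t)) refl u v (P h) (P S) (P (S ++ T)) ⟩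
    P h * (u * P S + v * P (S ++ T)) ∎)

  scale : ∀ {u as bs cs} → u * P as + P cs ≈ P bs → ∀ m → u * (P m * P as) + P m * P cs ≈ P m * P bs
  scale {u} {as} {bs} {cs} h m = trans
    (solve 4 (λ u m a c → u :* (m :* a) :+ m :* c := m :* (u :* a :+ c)) refl u (P m) (P as) (P cs))
    (*-congˡ h)

  relation1× = scale {as = a1} {b1} {c1} relation1
  relation2× = scale {as = a2} {b2} {c2} relation2
  relation3× = scale {as = a3} {b3} {c3} relation3
  relation4× = scale {as = a4} {b4} {c4} relation4
  relation5× = scale {as = a5} {b5} {c5} relation5

  -- The four product identities

  -- Three relations contain nine products. The cofactors `m1`, `m2`, `m3` make six of these agree
  -- in pairs, here a3 with b2, c3 with b1, and a2 with a1. The pairs are eliminated, and the three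
  -- products that remain have the common factor `h`, which leaves [T], [S] and [S] [T]. The other
  -- three identities follow the same scheme.
  identity-i : P (± T-i) ≈ q ^ 1 * P (± S-i) + q ^ 0 * P (± S-i ++ ± T-i)
  identity-i = combine h {± S-i} {± T-i} {m3} {b3} {m2} {c2} {m1} {c1} ≡.refl ≡.refl ≡.refl ≡.refl (begin
      P m3 * P b3
        ≈⟨ relation3× m3 ⟨
      ±q false 1 * (P m3 * P a3) + P m3 * P c3
        ≈⟨ +-cong (*-congˡ (P-product m3 a3 m2 b2 ≡.refl)) (P-product m3 c3 m1 b1 ≡.refl) ⟩
      ±q false 1 * (P m2 * P b2) + P m1 * P b1
        ≈⟨ +-cong (*-congˡ (relation2× m2)) (relation1× m1) ⟨
      ±q false 1 * (±q true 1 * (P m2 * P a2) + P m2 * P c2) + (±q false 2 * (P m1 * P a1) + P m1 * P c1)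
        ≈⟨ +-congʳ (*-congˡ (+-congʳ (*-congˡ (P-product m2 a2 m1 a1 ≡.refl)))) ⟩
      ±q false 1 * (±q true 1 * (P m1 * P a1) + P m2 * P c2) + (±q false 2 * (P m1 * P a1) + P m1 * P c1)
        ≈⟨ solve 4 (λ q a c d →
             (q :* :1) :* (:- (q :* :1) :* a :+ c) :+ ((q :* (q :* :1)) :* a :+ d) := (q :* :1) :* c :+ :1 :* d)
             refl q (P m1 * P a1) (P m2 * P c2) (P m1 * P c1) ⟩
      q ^ 1 * (P m2 * P c2) + q ^ 0 * (P m1 * P c1) ∎)
    where
    h m1 m2 m3 : List ℕ
    h = ± (2 ∷ 2 ∷ 6 ∷ 14 ∷ 16 ∷ 18 ∷ 20 ∷ 22 ∷ [])
    m1 = ± (1 ∷ 1 ∷ 3 ∷ 7 ∷ 7 ∷ 9 ∷ 11 ∷ 11 ∷ 12 ∷ 13 ∷ 13 ∷ 15 ∷ 17 ∷ 17 ∷ 21 ∷ 23 ∷ 23 ∷ [])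
    m2 = ± (1 ∷ 7 ∷ 9 ∷ 11 ∷ 12 ∷ 13 ∷ 15 ∷ 17 ∷ 23 ∷ [])
    m3 = ± (1 ∷ 2 ∷ 3 ∷ 7 ∷ 11 ∷ 12 ∷ 13 ∷ 17 ∷ 20 ∷ 21 ∷ 22 ∷ 23 ∷ [])

  identity-ii : P (± T-ii) ≈ q ^ 2 * P (± S-ii) + q ^ 0 * P (± S-ii ++ ± T-ii)
  identity-ii = combine h {± S-ii} {± T-ii} {m4} {b4} {m5} {c5} {m1} {c1} ≡.refl ≡.refl ≡.refl ≡.refl (begin
      P m4 * P b4
        ≈⟨ relation4× m4 ⟨
      ±q true 4 * (P m4 * P a4) + P m4 * P c4
        ≈⟨ +-cong (*-congˡ (P-product m4 a4 m5 a5 ≡.refl)) (P-product m4 c4 m1 b1 ≡.refl) ⟩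
      ±q true 4 * (P m5 * P a5) + P m1 * P b1
        ≈⟨ +-congˡ (relation1× m1) ⟨
      ±q true 4 * (P m5 * P a5) + (±q false 2 * (P m1 * P a1) + P m1 * P c1)
        ≈⟨ +-congˡ (+-congʳ (*-congˡ (trans (P-product m1 a1 m5 b5 ≡.refl) (sym (relation5× m5))))) ⟩
      ±q true 4 * (P m5 * P a5) + (±q false 2 * (±q false 2 * (P m5 * P a5) + P m5 * P c5) + P m1 * P c1)
        -- The coefficient -q⁴ of relation 4 cancels q² · q², one factor coming from relation 1 and
        -- one from relation 5.
        ≈⟨ solve 4 (λ q a c d → let q² = q :* (q :* :1) in
             :- (q :* (q :* q²)) :* a :+ (q² :* (q² :* a :+ c) :+ d) := q² :* c :+ :1 :* d)
             refl q (P m5 * P a5) (P m5 * P c5) (P m1 * P c1) ⟩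
      q ^ 2 * (P m5 * P c5) + q ^ 0 * (P m1 * P c1) ∎)
    where
    h m1 m4 m5 : List ℕ
    h = ± (4 ∷ 6 ∷ 10 ∷ 10 ∷ 14 ∷ 16 ∷ 18 ∷ 22 ∷ [])
    m1 = ± (3 ∷ 5 ∷ 5 ∷ 7 ∷ 7 ∷ 9 ∷ 11 ∷ 11 ∷ 12 ∷ 13 ∷ 13 ∷ 15 ∷ 17 ∷ 17 ∷ 19 ∷ 19 ∷ 21 ∷ [])
    m4 = ± (3 ∷ 5 ∷ 7 ∷ 11 ∷ 12 ∷ 13 ∷ 17 ∷ 19 ∷ 21 ∷ [])
    m5 = ± (4 ∷ 5 ∷ 7 ∷ 9 ∷ 10 ∷ 11 ∷ 12 ∷ 13 ∷ 14 ∷ 15 ∷ 17 ∷ 19 ∷ [])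

  -- The relations are those of (i) with different pairs: a2 with c3, b2 with b1, and a1 with a3.
  -- The product that has coefficient -q in relation 2 is moved to the other side, so that c2 yields
  -- [T] and b3 yields [S].
  identity-iii : P (± T-iii) ≈ q ^ 1 * P (± S-iii) + q ^ 0 * P (± S-iii ++ ± T-iii)
  identity-iii = combine h {± S-iii} {± T-iii} {m2} {c2} {m3} {b3} {m1} {c1} ≡.refl ≡.refl ≡.refl ≡.refl (begin
      P m2 * P c2
        ≈⟨ solve 3 (λ q a c → c := (q :* :1) :* a :+ (:- (q :* :1) :* a :+ c)) refl q (P m2 * P a2) (P m2 * P c2) ⟩
      ±q false 1 * (P m2 * P a2) + (±q true 1 * (P m2 * P a2) + P m2 * P c2)
        ≈⟨ +-congˡ (relation2× m2) ⟩
      ±q false 1 * (P m2 * P a2) + P m2 * P b2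
        ≈⟨ +-cong (*-congˡ (P-product m2 a2 m3 c3 ≡.refl)) (trans (P-product m2 b2 m1 b1 ≡.refl) (sym (relation1× m1))) ⟩
      ±q false 1 * (P m3 * P c3) + (±q false 2 * (P m1 * P a1) + P m1 * P c1)
        ≈⟨ +-congˡ (+-congʳ (*-congˡ (P-product m1 a1 m3 a3 ≡.refl))) ⟩
      ±q false 1 * (P m3 * P c3) + (±q false 2 * (P m3 * P a3) + P m1 * P c1)
        ≈⟨ solve 4 (λ q a c d →
             (q :* :1) :* c :+ ((q :* (q :* :1)) :* a :+ d) := (q :* :1) :* ((q :* :1) :* a :+ c) :+ :1 :* d)
             refl q (P m3 * P a3) (P m3 * P c3) (P m1 * P c1) ⟩
      ±q false 1 * (±q false 1 * (P m3 * P a3) + P m3 * P c3) + q ^ 0 * (P m1 * P c1)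
        ≈⟨ +-congʳ (*-congˡ (relation3× m3)) ⟩
      q ^ 1 * (P m3 * P b3) + q ^ 0 * (P m1 * P c1) ∎)
    where
    h m1 m2 m3 : List ℕ
    h = ± (2 ∷ 4 ∷ 6 ∷ 10 ∷ 14 ∷ 14 ∷ 16 ∷ 18 ∷ [])
    m1 = ± (1 ∷ 1 ∷ 3 ∷ 5 ∷ 5 ∷ 7 ∷ 7 ∷ 9 ∷ 12 ∷ 15 ∷ 17 ∷ 17 ∷ 19 ∷ 19 ∷ 21 ∷ 23 ∷ 23 ∷ [])
    m2 = ± (1 ∷ 5 ∷ 7 ∷ 9 ∷ 12 ∷ 15 ∷ 17 ∷ 19 ∷ 23 ∷ [])
    m3 = ± (1 ∷ 3 ∷ 4 ∷ 5 ∷ 7 ∷ 10 ∷ 12 ∷ 14 ∷ 17 ∷ 19 ∷ 21 ∷ 23 ∷ [])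

  -- The relations are those of (ii) with different pairs. Relation 1 now enters through a5, which
  -- has coefficient q² in relation 5, and no longer through c4; hence [S] [T] acquires the factor
  -- q² that [S] has in (ii).
  identity-iv : P (± T-iv) ≈ q ^ 0 * P (± S-iv) + q ^ 2 * P (± S-iv ++ ± T-iv)
  identity-iv = combine h {± S-iv} {± T-iv} {m4} {b4} {m5} {c5} {m1} {c1} ≡.refl ≡.refl ≡.refl ≡.refl (begin
      P m4 * P b4
        ≈⟨ relation4× m4 ⟨
      ±q true 4 * (P m4 * P a4) + P m4 * P c4
        ≈⟨ +-cong (*-congˡ (P-product m4 a4 m1 a1 ≡.refl)) (trans (P-product m4 c4 m5 b5 ≡.refl) (sym (relation5× m5))) ⟩
      ±q true 4 * (P m1 * P a1) + (±q false 2 * (P m5 * P a5) + P m5 * P c5)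
        ≈⟨ +-congˡ (+-congʳ (*-congˡ (trans (P-product m5 a5 m1 b1 ≡.refl) (sym (relation1× m1))))) ⟩
      ±q true 4 * (P m1 * P a1) + (±q false 2 * (±q false 2 * (P m1 * P a1) + P m1 * P c1) + P m5 * P c5)
        ≈⟨ solve 4 (λ q a c d → let q² = q :* (q :* :1) in
             :- (q :* (q :* q²)) :* a :+ (q² :* (q² :* a :+ d) :+ c) := :1 :* c :+ q² :* d)
             refl q (P m1 * P a1) (P m5 * P c5) (P m1 * P c1) ⟩
      q ^ 0 * (P m5 * P c5) + q ^ 2 * (P m1 * P c1) ∎)
    where
    h m1 m4 m5 : List ℕ
    h = ± (2 ∷ 6 ∷ 10 ∷ 16 ∷ 18 ∷ 20 ∷ 22 ∷ 22 ∷ [])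
    m1 = ± (1 ∷ 1 ∷ 3 ∷ 5 ∷ 5 ∷ 9 ∷ 11 ∷ 11 ∷ 12 ∷ 13 ∷ 13 ∷ 15 ∷ 19 ∷ 19 ∷ 21 ∷ 23 ∷ 23 ∷ [])
    m4 = ± (1 ∷ 3 ∷ 5 ∷ 11 ∷ 12 ∷ 13 ∷ 19 ∷ 21 ∷ 23 ∷ [])
    m5 = ± (1 ∷ 2 ∷ 5 ∷ 9 ∷ 11 ∷ 12 ∷ 13 ∷ 15 ∷ 19 ∷ 20 ∷ 22 ∷ 23 ∷ [])

-- Truncated power series and partition counts

boundedSum : (ℕ → ℕ) → ℕ → ℕ → ℕ → ℕ
boundedSum f k zero    r = f r
boundedSum f k (suc t) r = if k ℕ.≤ᵇ r then f r ℕ.+ boundedSum f k t (r ℕ.∸ k) else f r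

-- The local function of multSum has no name outside its where block: the underscore in
-- go≡boundedSum stands for it and is solved from the use in multSum≡boundedSum.
mutual
  multSum≡boundedSum : ∀ f k n → multSum f k n ≡ boundedSum f k n n
  multSum≡boundedSum f k zero = ≡.refl
  -- Naming `suc n` and `N ∸ k` by variables makes the local function appear applied to distinct
  -- variables, which determines the underscore below.
  multSum≡boundedSum f k (suc n) with suc n
  ... | N with k ℕ.≤ᵇ N
  ... | false = ≡.refl
  ... | true with N ℕ.∸ k
  ... | r = ≡.cong (f N ℕ.+_) (go≡boundedSum f k N n r)

  go≡boundedSum : ∀ f k N t r → _ ≡ boundedSum f k t r
  go≡boundedSum f k N zero    r = ≡.refl
  go≡boundedSum f k N (suc t) r with k ℕ.≤ᵇ r
  ... | true  = ≡.cong (f r ℕ.+_) (go≡boundedSum f k N t (r ℕ.∸ k))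
  ... | false = ≡.refl

Series : Set
Series = ℕ → ℤ

infixl 7 _⊛_
_⊛_ : Series → Series → Series
(f ⊛ g) zero    = f 0 ℤ.* g 0
(f ⊛ g) (suc n) = f 0 ℤ.* g (suc n) ℤ.+ (f ∘ suc ⊛ g) n

𝟘 𝟙 X : Series
𝟘 _ = + 0
𝟙 zero    = + 1
𝟙 (suc _) = + 0
X zero    = + 0
X (suc n) = 𝟙 n

⊛-cong : ∀ n {f f′ g g′ : Series} → (∀ i → i ℕ.≤ n → f i ≡ f′ i) → (∀ i → i ℕ.≤ n → g i ≡ g′ i) →
  (f ⊛ g) n ≡ (f′ ⊛ g′) n
⊛-cong zero    hf hg = ≡.cong₂ ℤ._*_ (hf 0 z≤n) (hg 0 z≤n)
⊛-cong (suc n) hf hg = ≡.cong₂ ℤ._+_ (≡.cong₂ ℤ._*_ (hf 0 z≤n) (hg (suc n) ℕₚ.≤-refl))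
  (⊛-cong n (λ i i≤n → hf (suc i) (s≤s i≤n)) (λ i i≤n → hg i (ℕₚ.m≤n⇒m≤1+n i≤n)))

⊛-sucʳ : ∀ n (f g : Series) → (f ⊛ g) (suc n) ≡ (f ⊛ g ∘ suc) n ℤ.+ f (suc n) ℤ.* g 0
⊛-sucʳ zero    f g = ≡.refl
⊛-sucʳ (suc n) f g = ≡.trans (≡.cong (ℤ._+_ (f 0 ℤ.* g (suc (suc n)))) (⊛-sucʳ n (f ∘ suc) g)) (≡.sym (ℤₚ.+-assoc (f 0 ℤ.* g (suc (suc n))) _ _))

⊛-comm : ∀ n (f g : Series) → (f ⊛ g) n ≡ (g ⊛ f) n
⊛-comm zero    f g = ℤₚ.*-comm (f 0) (g 0)
⊛-comm (suc n) f g = begin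
  f 0 ℤ.* g (suc n) ℤ.+ (f ∘ suc ⊛ g) n  ≡⟨ ≡.cong₂ ℤ._+_ (ℤₚ.*-comm (f 0) _) (⊛-comm n (f ∘ suc) g) ⟩
  g (suc n) ℤ.* f 0 ℤ.+ (g ⊛ f ∘ suc) n  ≡⟨ ℤₚ.+-comm (g (suc n) ℤ.* f 0) _ ⟩
  (g ⊛ f ∘ suc) n ℤ.+ g (suc n) ℤ.* f 0  ≡⟨ ⊛-sucʳ n g f ⟨
  (g ⊛ f) (suc n)                        ∎
  where open ≡.≡-Reasoning

⊛-distribʳ : ∀ n (h f g : Series) → ((λ i → f i ℤ.+ g i) ⊛ h) n ≡ (f ⊛ h) n ℤ.+ (g ⊛ h) n
⊛-distribʳ zero    h f g = ℤₚ.*-distribʳ-+ (h 0) (f 0) (g 0)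
⊛-distribʳ (suc n) h f g = ≡.trans
  (≡.cong (λ t → (f 0 ℤ.+ g 0) ℤ.* h (suc n) ℤ.+ t) (⊛-distribʳ n h (f ∘ suc) (g ∘ suc)))
  (lemma (f 0) (g 0) (h (suc n)) _ _)
  where
  lemma : ∀ a b c u v → (a ℤ.+ b) ℤ.* c ℤ.+ (u ℤ.+ v) ≡ (a ℤ.* c ℤ.+ u) ℤ.+ (b ℤ.* c ℤ.+ v)
  lemma = solve-∀

⊛-scale : ∀ n c (f g : Series) → ((λ i → c ℤ.* f i) ⊛ g) n ≡ c ℤ.* (f ⊛ g) n
⊛-scale zero    c f g = ℤₚ.*-assoc c (f 0) (g 0)
⊛-scale (suc n) c f g = ≡.trans (≡.cong (λ t → c ℤ.* f 0 ℤ.* g (suc n) ℤ.+ t) (⊛-scale n c (f ∘ suc) g))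
  (lemma c (f 0) (g (suc n)) _)
  where
  lemma : ∀ c a b u → c ℤ.* a ℤ.* b ℤ.+ c ℤ.* u ≡ c ℤ.* (a ℤ.* b ℤ.+ u)
  lemma = solve-∀

⊛-assoc : ∀ n (f g h : Series) → ((f ⊛ g) ⊛ h) n ≡ (f ⊛ (g ⊛ h)) n
⊛-assoc zero    f g h = ℤₚ.*-assoc (f 0) (g 0) (h 0)
⊛-assoc (suc n) f g h = begin
  f 0 ℤ.* g 0 ℤ.* h (suc n) ℤ.+ ((λ i → f 0 ℤ.* g (suc i) ℤ.+ (f ∘ suc ⊛ g) i) ⊛ h) n
    ≡⟨ ≡.cong (ℤ._+_ (f 0 ℤ.* g 0 ℤ.* h (suc n))) (≡.trans (⊛-distribʳ n h (λ i → f 0 ℤ.* g (suc i)) (f ∘ suc ⊛ g))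
         (≡.cong₂ ℤ._+_ (⊛-scale n (f 0) (g ∘ suc) h) (⊛-assoc n (f ∘ suc) g h))) ⟩
  f 0 ℤ.* g 0 ℤ.* h (suc n) ℤ.+ (f 0 ℤ.* (g ∘ suc ⊛ h) n ℤ.+ (f ∘ suc ⊛ (g ⊛ h)) n)
    ≡⟨ lemma (f 0) (g 0) (h (suc n)) _ _ ⟩
  f 0 ℤ.* (g 0 ℤ.* h (suc n) ℤ.+ (g ∘ suc ⊛ h) n) ℤ.+ (f ∘ suc ⊛ (g ⊛ h)) n ∎
  where
  open ≡.≡-Reasoning
  lemma : ∀ a b c u v → a ℤ.* b ℤ.* c ℤ.+ (a ℤ.* u ℤ.+ v) ≡ a ℤ.* (b ℤ.* c ℤ.+ u) ℤ.+ v
  lemma = solve-∀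

⊛-zeroˡ : ∀ n (g : Series) → (𝟘 ⊛ g) n ≡ + 0
⊛-zeroˡ zero    g = ≡.refl
⊛-zeroˡ (suc n) g = ≡.trans (ℤₚ.+-identityˡ _) (⊛-zeroˡ n g)

⊛-identityˡ : ∀ n (g : Series) → (𝟙 ⊛ g) n ≡ g n
⊛-identityˡ zero    g = ℤₚ.*-identityˡ (g 0)
⊛-identityˡ (suc n) g = ≡.trans (≡.cong₂ ℤ._+_ (ℤₚ.*-identityˡ (g (suc n))) (⊛-zeroˡ n g)) (ℤₚ.+-identityʳ _)

X⊛-suc : ∀ n (g : Series) → (X ⊛ g) (suc n) ≡ g n
X⊛-suc n g = ≡.trans (ℤₚ.+-identityˡ _) (⊛-identityˡ n g)

-- The quotient ℤ[[q]]/(q^m) as a setoid: elements remain full series and only equality forgets the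
-- coefficients from m on, so that an equation can be evaluated directly at any index below m.
truncatedSeries : ℕ → CommutativeRing 0ℓ 0ℓ
truncatedSeries m = record
  { Carrier = Series
  ; _≈_ = λ f g → ∀ i → i ℕ.< m → f i ≡ g i
  ; _+_ = λ f g i → f i ℤ.+ g i
  ; _*_ = _⊛_
  ; -_ = λ f i → ℤ.- f i
  ; 0# = 𝟘
  ; 1# = 𝟙
  ; isCommutativeRing = record
    { isRing = record
      { +-isAbelianGroup = record
        { isGroup = record
          { isMonoid = record
            { isSemigroup = record
              { isMagma = record
                { isEquivalence = record
                  { refl = λ i _ → ≡.refl
                  ; sym = λ h i i<m → ≡.sym (h i i<m)
                  ; trans = λ h h′ i i<m → ≡.trans (h i i<m) (h′ i i<m)
                  }
                ; ∙-cong = λ h h′ i i<m → ≡.cong₂ ℤ._+_ (h i i<m) (h′ i i<m)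
                }
              ; assoc = λ f g h i _ → ℤₚ.+-assoc (f i) (g i) (h i)
              }
            ; identity = (λ f i _ → ℤₚ.+-identityˡ (f i)) , (λ f i _ → ℤₚ.+-identityʳ (f i))
            }
          ; inverse = (λ f i _ → ℤₚ.+-inverseˡ (f i)) , (λ f i _ → ℤₚ.+-inverseʳ (f i))
          ; ⁻¹-cong = λ h i i<m → ≡.cong ℤ.-_ (h i i<m)
          }
        ; comm = λ f g i _ → ℤₚ.+-comm (f i) (g i)
        }
      ; *-cong = λ h h′ n n<m → ⊛-cong n (λ i i≤n → h i (ℕₚ.≤-<-trans i≤n n<m)) (λ i i≤n → h′ i (ℕₚ.≤-<-trans i≤n n<m))
      ; *-assoc = λ f g h n _ → ⊛-assoc n f g h
      ; *-identity = (λ g n _ → ⊛-identityˡ n g) , (λ g n _ → ≡.trans (⊛-comm n g 𝟙) (⊛-identityˡ n g))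
      ; distrib = (λ f g h n _ → ≡.trans (⊛-comm n f _) (≡.trans (⊛-distribʳ n f g h) (≡.cong₂ ℤ._+_ (⊛-comm n g f) (⊛-comm n h f))))
                , (λ h f g n _ → ⊛-distribʳ n h f g)
      }
    ; *-comm = λ f g n _ → ⊛-comm n f g
    }
  }

-- Recurrences for the partition counts

boundedSum-fuel : ∀ f k {t t′} r → r ℕ.≤ t → r ℕ.≤ t′ → boundedSum f (suc k) t r ≡ boundedSum f (suc k) t′ r
boundedSum-fuel f k {zero}  {zero}   r       _ _ = ≡.refl
boundedSum-fuel f k {zero}  {suc t′} zero    _ _ = ≡.refl
boundedSum-fuel f k {suc t} {zero}   zero    _ _ = ≡.refl
boundedSum-fuel f k {suc t} {suc t′} zero    _ _ = ≡.refl
boundedSum-fuel f k {suc t} {suc t′} (suc r) (s≤s r≤t) (s≤s r≤t′) with k ℕ.<ᵇ suc r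
... | false = ≡.refl
... | true  = ≡.cong (f (suc r) ℕ.+_) (boundedSum-fuel f k (r ∸ k)
  (ℕₚ.≤-trans (ℕₚ.m∸n≤m r k) r≤t) (ℕₚ.≤-trans (ℕₚ.m∸n≤m r k) r≤t′))

multSum-< : ∀ f k n → n ℕ.≤ k → multSum f (suc k) n ≡ f n
multSum-< f k n n≤k = ≡.trans (multSum≡boundedSum f (suc k) n) (lemma n n≤k)
  where
  lemma : ∀ n → n ℕ.≤ k → boundedSum f (suc k) n n ≡ f n
  lemma zero    _   = ≡.refl
  lemma (suc n) n<k with k ℕ.<ᵇ suc n | ℕₚ.<ᵇ⇒< k (suc n)
  ... | false | _ = ≡.refl
  ... | true  | h = contradiction (h _) (ℕₚ.≤⇒≯ n<k)

-- Multiplicity 0 is separated from the positive ones. Together with `multSum-<` this is the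
-- coefficientwise form of (1 - q^(k+1)) G = f, where G is the series of the sums over
-- multiplicities.
multSum-+ : ∀ f k n → multSum f (suc k) (suc k ℕ.+ n) ≡ f (suc k ℕ.+ n) ℕ.+ multSum f (suc k) n
multSum-+ f k n = ≡.trans (multSum≡boundedSum f (suc k) (suc k ℕ.+ n))
  (≡.trans step (≡.cong (f (suc k ℕ.+ n) ℕ.+_) (≡.sym (multSum≡boundedSum f (suc k) n))))
  where
  step : boundedSum f (suc k) (suc k ℕ.+ n) (suc k ℕ.+ n) ≡ f (suc k ℕ.+ n) ℕ.+ boundedSum f (suc k) n n
  step with k ℕ.<ᵇ suc (k ℕ.+ n) | ℕₚ.<⇒<ᵇ {k} {suc (k ℕ.+ n)} (s≤s (ℕₚ.m≤m+n k n))
  ... | true | _ = ≡.cong (f (suc k ℕ.+ n) ℕ.+_) (≡.trans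
    (≡.cong (boundedSum f (suc k) (k ℕ.+ n)) (ℕₚ.m+n∸m≡n k n))
    (boundedSum-fuel f k n (ℕₚ.m≤n+m n k) ℕₚ.≤-refl))

count-stable : ∀ S n k → count S (k ℕ.+ n) n ≡ p S n
count-stable S n zero    = ≡.refl
count-stable S n (suc k) with S (suc k ℕ.+ n)
... | false = count-stable S n k
... | true  = ≡.trans (multSum-< (count S (k ℕ.+ n)) (k ℕ.+ n) n (ℕₚ.m≤n+m n k)) (count-stable S n k)

any-cong : ∀ {f g : ℕ → Bool} → (∀ r → f r ≡ g r) → ∀ rs → any f rs ≡ any g rs
any-cong h []       = ≡.refl
any-cong h (r ∷ rs) = ≡.cong₂ _∨_ (h r) (any-cong h rs)

pmSet-periodic : ∀ rs i j → pmSet 48 rs (suc (j ℕ.+ i ℕ.* 48)) ≡ pmSet 48 rs (suc j)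
pmSet-periodic rs i j = any-cong (λ r → ≡.cong₂ _∨_
  (≡.cong (ℕ._≡ᵇ (r ℕ.% 48)) ([m+kn]%n≡m%n (suc j) i 48))
  (≡.cong (ℕ._≡ᵇ 0) (≡.trans (≡.cong (ℕ._% 48) (lemma r i j)) ([m+kn]%n≡m%n (suc j ℕ.+ r) i 48)))) rs
  where
  lemma : ∀ r i j → suc (j ℕ.+ i ℕ.* 48) ℕ.+ r ≡ (suc j ℕ.+ r) ℕ.+ i ℕ.* 48
  lemma = ℕ-Solver.solve-∀

members : (ℕ → Bool) → ℕ → ℕ → List ℕ
members S zero    r = []
members S (suc n) r = if S r then r ∷ members S n (suc r) else members S n (suc r)

module PowersOfX (m : ℕ) where
  open RingTheory (truncatedSeries m) using (_^_; _≈_; 0#)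

  X^-low : ∀ k (g : Series) i → i ℕ.< k → ((X ^ k) ⊛ g) i ≡ + 0
  X^-low (suc k) g zero    _         = ≡.refl
  X^-low (suc k) g (suc i) (s≤s i<k) = ≡.trans (⊛-assoc (suc i) X (X ^ k) g)
    (≡.trans (X⊛-suc i ((X ^ k) ⊛ g)) (X^-low k g i i<k))

  X^-high : ∀ k (g : Series) i → ((X ^ k) ⊛ g) (k ℕ.+ i) ≡ g i
  X^-high zero    g i = ⊛-identityˡ i g
  X^-high (suc k) g i = ≡.trans (⊛-assoc (suc (k ℕ.+ i)) X (X ^ k) g)
    (≡.trans (X⊛-suc (k ℕ.+ i) ((X ^ k) ⊛ g)) (X^-high k g i))

  ⊛-X^ : ∀ k i → (X ^ k) i ≡ ((X ^ k) ⊛ 𝟙) i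
  ⊛-X^ k i = ≡.sym (≡.trans (⊛-comm i (X ^ k) 𝟙) (⊛-identityˡ i (X ^ k)))

  -- `Level48` takes the order of nilpotency in the form 48 K; with K = m the power vanishes because
  -- 48 m ≥ m.
  X^[48m]≈0 : X ^ (48 ℕ.* m) ≈ 0#
  X^[48m]≈0 i i<m = ≡.trans (⊛-X^ (48 ℕ.* m) i)
    (X^-low (48 ℕ.* m) 𝟙 i (ℕₚ.<-≤-trans i<m (ℕₚ.m≤m+n m (47 ℕ.* m))))

-- Generating functions as inverses of products over residue classes

module Coefficients (m : ℕ) where
  open PowersOfX m
  open Level48 (truncatedSeries m) X m X^[48m]≈0 hiding (S; n)

  counts : (ℕ → Bool) → ℕ → Series
  counts S k i = + count S k i

  factor : (ℕ → Bool) → ℕ → Series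
  factor S k = if S k then 𝟙 - X ^ k else 𝟙

  factor*counts : ∀ S k → factor S (suc k) * counts S (suc k) ≈ counts S k
  factor*counts S k with S (suc k)
  ... | false = *-identityˡ _
  ... | true  = λ i i<m → ≡.trans (expand i) (go i)
    where
    G : Series
    G i = + multSum (count S k) (suc k) i
    expand : ∀ i → ((𝟙 - X ^ suc k) ⊛ G) i ≡ G i ℤ.- ((X ^ suc k) ⊛ G) i
    expand i = ≡.trans (⊛-distribʳ i G 𝟙 (- (X ^ suc k))) (≡.cong₂ ℤ._+_ (⊛-identityˡ i G)
      (≡.trans (⊛-cong i (λ j _ → ≡.sym (ℤₚ.-1*i≡-i ((X ^ suc k) j))) (λ _ _ → ≡.refl))
        (≡.trans (⊛-scale i (ℤ.- + 1) (X ^ suc k) G) (ℤₚ.-1*i≡-i _))))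
    go : ∀ i → G i ℤ.- ((X ^ suc k) ⊛ G) i ≡ + count S k i
    go i with suc k ℕ.≤? i
    ... | no k≰i = ≡.trans (≡.cong (λ t → G i ℤ.- t) (X^-low (suc k) G i (ℕₚ.≰⇒> k≰i)))
      (≡.trans (ℤₚ.+-identityʳ (G i)) (≡.cong +_ (multSum-< (count S k) k i (ℕₚ.≤-pred (ℕₚ.≰⇒> k≰i)))))
    ... | yes k<i with i ∸ suc k | ℕₚ.m+[n∸m]≡n k<i
    ... | j | ≡.refl = ≡.trans (≡.cong₂ ℤ._-_ (≡.cong +_ (multSum-+ (count S k) k j)) (X^-high (suc k) G j))
      (lemma (+ count S k (suc k ℕ.+ j)) (G j))
      where
      lemma : ∀ a b → (a ℤ.+ b) ℤ.- b ≡ a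
      lemma = solve-∀

  counts-0 : ∀ S → counts S 0 ≈ 1#
  counts-0 S zero    _ = ≡.refl
  counts-0 S (suc i) _ = ≡.refl

  ∏-factor*counts : ∀ S k → ∏ k (λ j → factor S (suc j)) * counts S k ≈ 1#
  ∏-factor*counts S zero    = trans (*-identityˡ (counts S 0)) (counts-0 S)
  ∏-factor*counts S (suc k) = begin
    ∏ (suc k) (λ j → factor S (suc j)) * counts S (suc k)
      ≈⟨ *-congʳ (∏-snoc k (λ j → factor S (suc j))) ⟩
    (∏ k (λ j → factor S (suc j)) * factor S (suc k)) * counts S (suc k)
      ≈⟨ *-assoc (∏ k (λ j → factor S (suc j))) (factor S (suc k)) (counts S (suc k)) ⟩
    ∏ k (λ j → factor S (suc j)) * (factor S (suc k) * counts S (suc k))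
      ≈⟨ *-congˡ {∏ k (λ j → factor S (suc j))} (factor*counts S k) ⟩
    ∏ k (λ j → factor S (suc j)) * counts S k
      ≈⟨ ∏-factor*counts S k ⟩
    1# ∎

  ∏-blocks : ∀ k b (g : ℕ → Series) → ∏ (k ℕ.* b) g ≈ ∏ k (λ i → ∏ b (λ j → g (j ℕ.+ i ℕ.* b)))
  ∏-blocks zero    b g = refl
  ∏-blocks (suc k) b g = begin
    ∏ (b ℕ.+ k ℕ.* b) g
      ≈⟨ ∏-split b (k ℕ.* b) g ⟩
    ∏ b g * ∏ (k ℕ.* b) (λ i → g (b ℕ.+ i))
      ≈⟨ *-cong (∏-cong b λ j → reflexive (≡.cong g (≡.sym (ℕₚ.+-identityʳ j))))
           (trans (∏-blocks k b (λ i → g (b ℕ.+ i)))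
             (∏-cong k λ i → ∏-cong b λ j → reflexive (≡.cong g (lemma b j (i ℕ.* b))))) ⟩
    ∏ b (λ j → g (j ℕ.+ 0)) * ∏ k (λ i → ∏ b (λ j → g (j ℕ.+ suc i ℕ.* b))) ∎
    where
    lemma : ∀ b j t → b ℕ.+ (j ℕ.+ t) ≡ j ℕ.+ (b ℕ.+ t)
    lemma = ℕ-Solver.solve-∀

  F-factor : (ℕ → Bool) → ℕ → Series
  F-factor S r = if S r then F r else 𝟙

  P-members : ∀ S k r → ∏ k (λ j → F-factor S (j ℕ.+ r)) ≈ P (members S k r)
  P-members S zero    r = refl
  P-members S (suc k) r = trans (*-congˡ {F-factor S r} (trans
    (∏-cong k λ j → reflexive (≡.cong (F-factor S) (≡.sym (ℕₚ.+-suc j r)))) (P-members S k (suc r)))) cons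
    where
    cons : F-factor S r * P (members S k (suc r)) ≈ P (members S (suc k) r)
    cons with S r
    ... | true  = refl
    ... | false = *-identityˡ (P (members S k (suc r)))

  -- The parts up to 48 m form m blocks of length 48. After the two products are exchanged,
  -- periodicity makes each residue contribute either a full `F` or 1.
  ∏-factor : ∀ rs → let S = pmSet 48 rs in
    ∏ (m ℕ.* 48) (λ j → factor S (suc j)) ≈ P (members S 48 1)
  ∏-factor rs = begin
    ∏ (m ℕ.* 48) (λ j → factor S (suc j))
      ≈⟨ ∏-blocks m 48 (λ j → factor S (suc j)) ⟩
    ∏ m (λ i → ∏ 48 (λ j → factor S (suc (j ℕ.+ i ℕ.* 48))))
      ≈⟨ ∏-swap m 48 (λ i j → factor S (suc (j ℕ.+ i ℕ.* 48))) ⟩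
    ∏ 48 (λ j → ∏ m (λ i → factor S (suc (j ℕ.+ i ℕ.* 48))))
      ≈⟨ ∏-cong 48 column ⟩
    ∏ 48 (λ j → F-factor S (j ℕ.+ 1))
      ≈⟨ P-members S 48 1 ⟩
    P (members S 48 1) ∎
    where
    S = pmSet 48 rs
    column : ∀ j → ∏ m (λ i → factor S (suc (j ℕ.+ i ℕ.* 48))) ≈ F-factor S (j ℕ.+ 1)
    column j = begin
      ∏ m (λ i → factor S (suc (j ℕ.+ i ℕ.* 48)))
        ≈⟨ ∏-cong m (λ i → reflexive (≡.cong₂ (λ b e → if b then 𝟙 - X ^ e else 𝟙) (pmSet-periodic rs i j) (lemma j i))) ⟩
      ∏ m (λ i → if S (suc j) then 𝟙 - X ^ (suc j ℕ.+ 48 ℕ.* i) else 𝟙)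
        ≈⟨ constant (S (suc j)) ⟩
      F-factor S (suc j)
        ≈⟨ reflexive (≡.cong (F-factor S) (ℕₚ.+-comm 1 j)) ⟩
      F-factor S (j ℕ.+ 1) ∎
      where
      lemma : ∀ j i → suc (j ℕ.+ i ℕ.* 48) ≡ suc j ℕ.+ 48 ℕ.* i
      lemma = ℕ-Solver.solve-∀
      constant : ∀ b → ∏ m (λ i → if b then 𝟙 - X ^ (suc j ℕ.+ 48 ℕ.* i) else 𝟙) ≈ (if b then F (suc j) else 𝟙)
      constant true  = refl
      constant false = ∏-1 m λ _ _ → refl

  generatingFunction : List ℕ → Series
  generatingFunction rs = counts (pmSet 48 rs) (m ℕ.* 48)

  -- The residues ±rs are distinct modulo 48, and so each part is counted once.
  Simple : List ℕ → Set
  Simple rs = sort (members (pmSet 48 rs) 48 1) ≡ sort (± rs)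

  P*generatingFunction : ∀ rs → Simple rs → P (± rs) * generatingFunction rs ≈ 1#
  P*generatingFunction rs e = trans
    (*-congʳ {generatingFunction rs} (trans (P-permute (± rs) (members (pmSet 48 rs) 48 1) (≡.sym e)) (sym (∏-factor rs))))
    (∏-factor*counts (pmSet 48 rs) (m ℕ.* 48))

  -- Multiplying `h` by `gS` and `gT`, the inverses of the two products, gives 1/[S] = u/[T] + v.
  generatingFunction-relation : ∀ rs ts u v → Simple rs → Simple ts →
    P (± ts) ≈ u * P (± rs) + v * P (± rs ++ ± ts) → generatingFunction rs ≈ u * generatingFunction ts + v
  generatingFunction-relation rs ts u v eS eT h = begin
    gS                                     ≈⟨ *-identityʳ gS ⟨
    gS * 1#                                ≈⟨ *-congˡ {gS} hT ⟨
    gS * (P (± ts) * gT)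
      ≈⟨ *-congˡ {gS} (*-congʳ {gT} (trans h (+-congˡ {u * P (± rs)} (*-congˡ {v} (P-++ (± rs) (± ts)))))) ⟩
    gS * ((u * P (± rs) + v * (P (± rs) * P (± ts))) * gT)
      ≈⟨ solve 6 (λ u v s t gS gT → gS :* ((u :* s :+ v :* (s :* t)) :* gT)
           := u :* gT :* (s :* gS) :+ v :* ((s :* gS) :* (t :* gT))) refl u v (P (± rs)) (P (± ts)) gS gT ⟩
    u * gT * (P (± rs) * gS) + v * ((P (± rs) * gS) * (P (± ts) * gT))
      ≈⟨ +-cong (*-congˡ {u * gT} hS) (*-congˡ {v} (*-cong hS hT)) ⟩
    u * gT * 1# + v * (1# * 1#)
      ≈⟨ +-cong (*-identityʳ (u * gT)) (trans (*-congˡ {v} (*-identityʳ 1#)) (*-identityʳ v)) ⟩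
    u * gT + v ∎
    where
    gS gT : Series
    gS = generatingFunction rs
    gT = generatingFunction ts
    hS : P (± rs) * gS ≈ 1#
    hS = P*generatingFunction rs eS
    hT : P (± ts) * gT ≈ 1#
    hT = P*generatingFunction ts eT

  generatingFunction-coefficient : ∀ rs i → i ℕ.< m → generatingFunction rs i ≡ + p (pmSet 48 rs) i
  generatingFunction-coefficient rs i i<m = ≡.cong +_ (≡.trans
    (≡.cong (λ k → count (pmSet 48 rs) k i) (≡.sym (ℕₚ.m∸n+n≡m (ℕₚ.≤-trans (ℕₚ.<⇒≤ i<m) (ℕₚ.m≤m*n m 48)))))
    (count-stable (pmSet 48 rs) i (m ℕ.* 48 ∸ i)))

  -- The coefficients of q^(s+i) in 1/[S] = q^s/[T] + q^t are compared; the last hypothesis keeps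
  -- away from the one index where q^t contributes.
  shifted : ∀ rs ts s t → Simple rs → Simple ts →
    P (± ts) ≈ X ^ s * P (± rs) + X ^ t * P (± rs ++ ± ts) →
    ∀ i → s ℕ.+ i ℕ.< m → (X ^ t) (s ℕ.+ i) ≡ + 0 → p (pmSet 48 rs) (s ℕ.+ i) ≡ p (pmSet 48 ts) i
  shifted rs ts s t eS eT h i s+i<m z = ℤₚ.+-injective
    (≡.trans (≡.sym (generatingFunction-coefficient rs (s ℕ.+ i) s+i<m))
    (≡.trans (generatingFunction-relation rs ts (X ^ s) (X ^ t) eS eT h (s ℕ.+ i) s+i<m)
    (≡.trans (≡.cong₂ ℤ._+_ (X^-high s (generatingFunction ts) i) z)
    (≡.trans (ℤₚ.+-identityʳ (generatingFunction ts i))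
             (generatingFunction-coefficient ts i (ℕₚ.≤-<-trans (ℕₚ.m≤n+m i s) s+i<m))))))

theorem7p6 : (∀ (n : ℕ) → n ≥ 1 →
    p (pmSet 48 (1 ∷ 4 ∷ 7 ∷ 9 ∷ 10 ∷ 11 ∷ 12 ∷ 13 ∷ 14 ∷ 15 ∷ 17 ∷ 23 ∷ [])) n
    ≡ p (pmSet 48 (1 ∷ 3 ∷ 7 ∷ 8 ∷ 10 ∷ 11 ∷ 12 ∷ 13 ∷ 17 ∷ 21 ∷ 22 ∷ 23 ∷ [])) (n ∸ 1))
    × (∀ (n : ℕ) → n ≥ 2 →
    p (pmSet 48 (2 ∷ 5 ∷ 7 ∷ 8 ∷ 9 ∷ 11 ∷ 12 ∷ 13 ∷ 14 ∷ 15 ∷ 17 ∷ 19 ∷ [])) n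
    ≡ p (pmSet 48 (2 ∷ 3 ∷ 5 ∷ 7 ∷ 11 ∷ 12 ∷ 13 ∷ 17 ∷ 19 ∷ 20 ∷ 21 ∷ 22 ∷ [])) (n ∸ 2))
    × (∀ (n : ℕ) → n ≥ 1 →
    p (pmSet 48 (1 ∷ 3 ∷ 5 ∷ 7 ∷ 8 ∷ 10 ∷ 12 ∷ 17 ∷ 19 ∷ 21 ∷ 22 ∷ 23 ∷ [])) n
    ≡ p (pmSet 48 (1 ∷ 2 ∷ 5 ∷ 7 ∷ 9 ∷ 12 ∷ 15 ∷ 17 ∷ 19 ∷ 20 ∷ 22 ∷ 23 ∷ [])) (n ∸ 1))
    × (∀ (n : ℕ) → n ≢ 2 →
    p (pmSet 48 (1 ∷ 2 ∷ 5 ∷ 8 ∷ 9 ∷ 11 ∷ 12 ∷ 13 ∷ 14 ∷ 15 ∷ 19 ∷ 23 ∷ [])) n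
    ≡ p (pmSet 48 (1 ∷ 3 ∷ 4 ∷ 5 ∷ 10 ∷ 11 ∷ 12 ∷ 13 ∷ 14 ∷ 19 ∷ 21 ∷ 23 ∷ [])) n)
theorem7p6 =
    -- The truncation order is one more than the index of the coefficient compared. In (i)-(iii) the
    -- correction is q⁰, whose coefficient at a positive index is 0 by evaluation.
    (λ { (suc n) _ → shifted (suc (suc n)) S-i T-i 1 0 ≡.refl ≡.refl (Id.identity-i (suc (suc n))) n ℕₚ.≤-refl ≡.refl })
  , (λ { (suc zero) (s≤s ()) ; (suc (suc n)) _ → shifted (3 ℕ.+ n) S-ii T-ii 2 0 ≡.refl ≡.refl (Id.identity-ii (3 ℕ.+ n)) n ℕₚ.≤-refl ≡.refl })
  , (λ { (suc n) _ → shifted (suc (suc n)) S-iii T-iii 1 0 ≡.refl ≡.refl (Id.identity-iii (suc (suc n))) n ℕₚ.≤-refl ≡.refl })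
  , (λ n n≢2 → shifted (suc n) S-iv T-iv 0 2 ≡.refl ≡.refl (Id.identity-iv (suc n)) n ℕₚ.≤-refl (X²-coefficient n n≢2))
  where
  open Coefficients using (shifted)
  module Id (m : ℕ) = Level48 (truncatedSeries m) X m (PowersOfX.X^[48m]≈0 m)
  X²-coefficient : ∀ n → n ≢ 2 → (X ⊛ (X ⊛ 𝟙)) n ≡ + 0
  X²-coefficient 0 _ = ≡.refl
  X²-coefficient 1 _ = ≡.refl
  X²-coefficient 2 n≢2 = contradiction ≡.refl n≢2
  X²-coefficient (suc (suc (suc n))) _ = ≡.trans (X⊛-suc (suc (suc n)) (X ⊛ 𝟙)) (X⊛-suc (suc n) 𝟙)
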